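{- For $i\in\{1,2\}$ let $G_i$ be a finite graph on $n_i$ vertices with maximum degree $\Delta(G_i)<\frac{1}{9}n_i-\frac{1}{3}$, and let $k_i$ be a natural number with $k_i>\chi(G_i)$. If $\mathcal{B}_{k_1}(G_1)\cong\mathcal{B}_{k_2}(G_2)$, then $G_1\cong G_2$. (That is, such a graph $G$ is uniquely determined by $\mathcal{B}_k(G)$ whenever $k>\chi(G)$, even without knowing $k$.)
   Context: All graphs are finite and simple; $\chi(G)$ is the chromatic number. An independent set partition of $G$ is a partition of $V(G)$ into nonempty independent sets (parts). For an independent set partition $P$ and $v\in V(G)$, let $P-v$ denote the partition of $V(G)\setminus\{v\}$ obtained by deleting $v$ from its part (discarding that part if it becomes empty). The Bell colouring graph $\mathcal{B}(G)$ has as vertices the independent set partitions of $G$, with $P\neq Q$ adjacent iff $P-v=Q-v$ for some $v\in V(G)$. For a natural number $k$, the Bell $k$-colouring graph $\mathcal{B}_k(G)$ is the induced subgraph of $\mathcal{B}(G)$ on the partitions with at most $k$ parts. -}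

module Defs where

open import Data.Nat using (ℕ; _+_; _*_; _<_; _⊔_)
open import Data.Fin using (Fin)
open import Data.List using (List; length; filter; map; foldr; allFin)
open import Data.Bool using (Bool; true)
open import Data.Product using (Σ; _×_; ∃; ∃-syntax)
open import Data.Empty using (⊥)
open import Relation.Nullary using (¬_; Dec)
open import Relation.Binary.PropositionalEquality using (_≡_; _≢_)
open import Function.Bundles using (_↔_; Inverse)

record Graph (n : ℕ) : Set₁ where
  field
    Adj    : Fin n → Fin n → Set
    adj?   : ∀ u v → Dec (Adj u v)
    sym    : ∀ {u v} → Adj u v → Adj v u
    irrefl : ∀ {u} → ¬ Adj u u
open Graph public

degree : ∀ {n} → Graph n → Fin n → ℕ
degree G v = length (filter (adj? G v) (allFin _))

maxDegree : ∀ {n} → Graph n → ℕ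
maxDegree {n} G = foldr _⊔_ 0 (map (degree G) (allFin n))

ProperColouring : ∀ {n} → Graph n → (m : ℕ) → (Fin n → Fin m) → Set
ProperColouring G m c = ∀ u v → Adj G u v → c u ≢ c v

Colourable : ∀ {n} → Graph n → ℕ → Set
Colourable {n} G m = Σ (Fin n → Fin m) (ProperColouring G m)

IsChromaticNumber : ∀ {n} → Graph n → ℕ → Set
IsChromaticNumber G χ = Colourable G χ × (∀ m → m < χ → ¬ Colourable G m)

_≅_ : ∀ {n₁ n₂} → Graph n₁ → Graph n₂ → Set
_≅_ {n₁} {n₂} G₁ G₂ =
  Σ (Fin n₁ ↔ Fin n₂) λ f →
    ∀ u v → (Adj G₁ u v → Adj G₂ (Inverse.to f u) (Inverse.to f v))
          × (Adj G₂ (Inverse.to f u) (Inverse.to f v) → Adj G₁ u v)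

-- An independent set partition of G, represented by its (decidable)
-- equivalence relation "u and v lie in the same part". Parts are nonempty
-- automatically (they are equivalence classes). Two partitions are equal
-- iff their relations agree pointwise (see _≈P_).
record IndepPartition {n} (G : Graph n) : Set where
  field
    same      : Fin n → Fin n → Bool
    same-refl : ∀ u → same u u ≡ true
    same-sym  : ∀ u v → same u v ≡ true → same v u ≡ true
    same-trans : ∀ u v w → same u v ≡ true → same v w ≡ true → same u w ≡ true
    independent : ∀ u v → same u v ≡ true → ¬ Adj G u v
open IndepPartition public

_≈P_ : ∀ {n} {G : Graph n} → IndepPartition G → IndepPartition G → Set
P ≈P Q = ∀ u v → same P u v ≡ same Q u v

AtMostParts : ∀ {n} {G : Graph n} → ℕ → IndepPartition G → Set
AtMostParts {n} k P =
  Σ (Fin n → Fin k) λ c → ∀ u v → (c u ≡ c v → same P u v ≡ true)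
                                × (same P u v ≡ true → c u ≡ c v)

AgreeOff : ∀ {n} {G : Graph n} → Fin n → IndepPartition G → IndepPartition G → Set
AgreeOff x P Q = ∀ u v → u ≢ x → v ≢ x → same P u v ≡ same Q u v

BellAdj : ∀ {n} {G : Graph n} → IndepPartition G → IndepPartition G → Set
BellAdj {n} P Q = ¬ (P ≈P Q) × ∃[ x ] AgreeOff x P Q

BellVertex : ∀ {n} → Graph n → ℕ → Set
BellVertex G k = Σ (IndepPartition G) (AtMostParts k)

record BellIso {n₁ n₂} (G₁ : Graph n₁) (k₁ : ℕ) (G₂ : Graph n₂) (k₂ : ℕ) : Set where
  field
    to   : BellVertex G₁ k₁ → BellVertex G₂ k₂
    from : BellVertex G₂ k₂ → BellVertex G₁ k₁
    to-cong   : ∀ P Q → Σ.proj₁ P ≈P Σ.proj₁ Q → Σ.proj₁ (to P) ≈P Σ.proj₁ (to Q)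
    from-cong : ∀ P Q → Σ.proj₁ P ≈P Σ.proj₁ Q → Σ.proj₁ (from P) ≈P Σ.proj₁ (from Q)
    from-to   : ∀ P → Σ.proj₁ (from (to P)) ≈P Σ.proj₁ P
    to-from   : ∀ Q → Σ.proj₁ (to (from Q)) ≈P Σ.proj₁ Q
    adj-pres  : ∀ P Q → BellAdj (Σ.proj₁ P) (Σ.proj₁ Q)
                      → BellAdj (Σ.proj₁ (to P)) (Σ.proj₁ (to Q))
    adj-refl  : ∀ P Q → BellAdj (Σ.proj₁ (to P)) (Σ.proj₁ (to Q))
                      → BellAdj (Σ.proj₁ P) (Σ.proj₁ Q)

{-# OPTIONS --safe #-}
module Submission where

-- Call a partition P separated if moving two different vertices of P never yields equal or
-- adjacent partitions. When every part has at least four vertices and a colour is free, P is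
-- separated and the partitions Q u obtained by isolating u represent n classes of neighbours of P;
-- an isomorphism carries P to a separated partition and so induces a bijection φ of the vertices.
--
-- If k = χ + 1 and u, v are adjacent then P is the only common neighbour of Q u and Q v, whereas for
-- non-adjacent moved vertices a second one always exists; hence φ preserves adjacency.
-- If k ≥ χ + 2 and u, v are non-adjacent then Q u and Q v have two adjacent common neighbours far
-- from P, with u and v together or apart. Provided that the Q u are separated as well (parts with
-- five vertices), such a pair forces the images of u and v to be non-adjacent and the other graph to
-- satisfy k ≥ χ + 2. So both graphs are in the same case, and injections that preserve a relation
-- in both directions are isomorphisms because their composite is periodic.
--
-- A χ-colouring with classes of size at least 5 arises by moving vertices into small classes; the
-- degree bound makes this possible once n > 12, and for n ≤ 12 it leaves no edges.

open import Defs
open import Data.Bool using (Bool; true; false)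
import Data.Bool as Bool
open import Data.Empty using (⊥; ⊥-elim)
open import Data.Fin using (Fin; punchIn; punchOut; toℕ; fromℕ<; inject≤; combine)
  renaming (zero to fzero; suc to fsuc)
open import Data.Fin.Properties using (_≟_; any?; all?; ¬∀⟶∃¬; injective⇒≤; pigeonhole;
  punchIn-punchOut; punchOut-injective; combine-injective; inject≤-injective; toℕ-inject≤;
  toℕ-fromℕ<; toℕ<n)
open import Data.List using (List; []; _∷_; _++_; length; filter; map; foldr; allFin; concatMap; lookup)
open import Data.List.Properties using (length-++; length-map; length-tabulate)
open import Data.List.Membership.Propositional using (_∈_; _∉_)
open import Data.List.Membership.Propositional.Properties
  using (∈-lookup; ∈-filter⁺; ∈-filter⁻; ∈-allFin; ∈-map⁺; ∈-++⁺ˡ; ∈-++⁺ʳ; ∈-concatMap⁺)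
open import Data.List.Relation.Unary.All using ([]; _∷_)
import Data.List.Relation.Unary.All as All
open import Data.List.Relation.Unary.AllPairs using ([]; _∷_)
open import Data.List.Relation.Unary.Any using (Any; here; there; index)
import Data.List.Relation.Unary.Any as Any
open import Data.List.Relation.Unary.Any.Properties using (lookup-index)
open import Data.List.Relation.Unary.Unique.Propositional using (Unique)
open import Data.List.Relation.Unary.Unique.Propositional.Properties using (allFin⁺; filter⁺)
open import Data.Nat using (ℕ; zero; suc; _+_; _*_; _∸_; _<_; _≤_; _⊔_; z≤n; s≤s; _≤?_; _<?_)
open import Data.Nat.GeneralisedArithmetic using (fold)
open import Data.Nat.Induction using (<-wellFounded)
open import Data.Nat.ListAction using (sum)
open import Data.Nat.Properties hiding (_≟_; suc-injective; ≡-irrelevant)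
open import Data.Nat.Solver using (module +-*-Solver)
open import Data.Product using (Σ; _×_; ∃-syntax; _,_; proj₁; proj₂)
open import Data.Sum using (_⊎_; inj₁; inj₂)
open import Data.Vec.Functional using (updateAt)
open import Data.Vec.Functional.Properties using (updateAt-updates; updateAt-minimal)
open import Function using (_∘_; const; id)
open import Function.Bundles using (_↔_; mk↔ₛ′; Inverse)
open import Function.Definitions using (Injective)
open import Induction.WellFounded using (Acc; acc)
open import Relation.Binary.PropositionalEquality
  using (_≡_; _≢_; refl; trans; cong; subst; subst₂; ≢-sym) renaming (sym to ≡-sym)
open import Relation.Nullary using (¬_; Dec; yes; no; does; ¬?; contradiction; _×-dec_; _→-dec_)
open import Relation.Nullary.Decidable using (decidable-stable; dec-true; map′)
open +-*-Solver using (solve; con; _:+_; _:*_; _:=_)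

-- Colourings with large classes

lookup-injective : ∀ {A : Set} {xs : List A} → Unique xs → ∀ i j → lookup xs i ≡ lookup xs j → i ≡ j
lookup-injective (x∉ ∷ u) fzero    fzero    e = refl
lookup-injective (x∉ ∷ u) fzero    (fsuc j) e = contradiction e (All.lookup x∉ (∈-lookup j))
lookup-injective (x∉ ∷ u) (fsuc i) fzero    e = contradiction (≡-sym e) (All.lookup x∉ (∈-lookup i))
lookup-injective (x∉ ∷ u) (fsuc i) (fsuc j) e = cong fsuc (lookup-injective u i j e)

unique-⊆-length : ∀ {A : Set} {xs ys : List A} → Unique xs →
                  (∀ {x} → x ∈ xs → x ∈ ys) → length xs ≤ length ys
unique-⊆-length {xs = xs} {ys} uniq sub = injective⇒≤ {f = f} λ {i} {j} eq →
  lookup-injective uniq i j (trans (at i) (trans (cong (lookup ys) eq) (≡-sym (at j))))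
  where
  f : Fin (length xs) → Fin (length ys)
  f i = index (sub (∈-lookup {xs = xs} i))
  at : ∀ i → lookup xs i ≡ lookup ys (f i)
  at i = lookup-index (sub (∈-lookup {xs = xs} i))

length-allFin : ∀ n → length (allFin n) ≡ n
length-allFin n = length-tabulate (λ (i : Fin n) → i)

covering-length : ∀ {n} (xs : List (Fin n)) → (∀ v → v ∈ xs) → n ≤ length xs
covering-length {n} xs cov =
  subst (_≤ length xs) (length-allFin n) (unique-⊆-length (allFin⁺ n) (λ {v} _ → cov v))

_∈?_ : ∀ {n} (v : Fin n) (xs : List (Fin n)) → Dec (v ∈ xs)
v ∈? xs = Any.any? (v ≟_) xs

∃-outside : ∀ {n} (xs ys : List (Fin n)) → Unique ys → length xs < length ys →
            ∃[ a ] a ∉ xs × a ∈ ys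
∃-outside xs ys uniq lt with any? (λ a → ¬? (a ∈? xs) ×-dec (a ∈? ys))
... | yes r = r
... | no ¬r = contradiction (unique-⊆-length uniq λ {a} a∈ →
                decidable-stable (a ∈? xs) (λ a∉ → ¬r (a , a∉ , a∈))) (<⇒≱ lt)

length-concatMap-≤ : ∀ {A B : Set} (f : A → List B) b → (∀ x → length (f x) ≤ b) →
                     ∀ xs → length (concatMap f xs) ≤ length xs * b
length-concatMap-≤ f b fb []       = z≤n
length-concatMap-≤ f b fb (x ∷ xs) = begin
  length (f x ++ concatMap f xs)             ≡⟨ length-++ (f x) ⟩
  length (f x) + length (concatMap f xs)     ≤⟨ +-mono-≤ (fb x) (length-concatMap-≤ f b fb xs) ⟩
  b + length xs * b                          ∎
  where open ≤-Reasoning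

sum-map-mono : ∀ {A : Set} (f g : A → ℕ) → (∀ x → f x ≤ g x) → ∀ xs → sum (map f xs) ≤ sum (map g xs)
sum-map-mono f g le []       = z≤n
sum-map-mono f g le (x ∷ xs) = +-mono-≤ (le x) (sum-map-mono f g le xs)

sum-map-strict : ∀ {A : Set} (f g : A → ℕ) → (∀ x → f x ≤ g x) → ∀ {y} → f y < g y →
                 ∀ {xs} → y ∈ xs → sum (map f xs) < sum (map g xs)
sum-map-strict f g le lt {x ∷ xs} (here refl) = +-mono-<-≤ lt (sum-map-mono f g le xs)
sum-map-strict f g le lt {x ∷ xs} (there y∈)  = +-mono-≤-< (le x) (sum-map-strict f g le lt y∈)

_[_≔_] : ∀ {n} {A : Set} → (Fin n → A) → Fin n → A → Fin n → A
c [ u ≔ x ] = updateAt c u (const x)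

≔-same : ∀ {n} {A : Set} (c : Fin n → A) u {x} → (c [ u ≔ x ]) u ≡ x
≔-same c u = updateAt-updates u c

≔-other : ∀ {n} {A : Set} (c : Fin n → A) {u v x} → v ≢ u → (c [ u ≔ x ]) v ≡ c v
≔-other c {u} {v} ne = updateAt-minimal v u c ne

neighbours : ∀ {n} → Graph n → Fin n → List (Fin n)
neighbours G v = filter (adj? G v) (allFin _)

∈-neighbours : ∀ {n} (G : Graph n) {u v} → Adj G v u → u ∈ neighbours G v
∈-neighbours G {u} a = ∈-filter⁺ (adj? G _) (∈-allFin u) a

≤-foldr-⊔ : ∀ {x} (xs : List ℕ) → x ∈ xs → x ≤ foldr _⊔_ 0 xs
≤-foldr-⊔ (y ∷ ys) (here refl) = m≤m⊔n y _
≤-foldr-⊔ (y ∷ ys) (there x∈)  = ≤-trans (≤-foldr-⊔ ys x∈) (m≤n⊔m y _)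

degree≤maxDegree : ∀ {n} (G : Graph n) v → degree G v ≤ maxDegree G
degree≤maxDegree {n} G v = ≤-foldr-⊔ (map (degree G) (allFin n)) (∈-map⁺ (degree G) (∈-allFin v))

-- Each new vertex has at most `maxDegree G` neighbours, which cannot block one colour more. The
-- colouring is total but constrained only on the list, so recolouring the head suffices.
greedy-on : ∀ {n} (G : Graph n) (xs : List (Fin n)) →
  Σ (Fin n → Fin (suc (maxDegree G))) λ c → ∀ {u v} → u ∈ xs → v ∈ xs → Adj G u v → c u ≢ c v
greedy-on G [] = const fzero , λ ()
greedy-on {n} G (x ∷ xs) with greedy-on G xs
... | c , proper with ∃-outside (map c (neighbours G x)) (allFin (suc (maxDegree G)))
                        (allFin⁺ _)
                        (subst₂ _<_ (≡-sym (length-map c (neighbours G x)))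
                          (≡-sym (length-allFin (suc (maxDegree G)))) (s≤s (degree≤maxDegree G x)))
... | free , free∉ , _ = c [ x ≔ free ] , proper'
  where
  in-tail : ∀ {u} → u ≢ x → u ∈ x ∷ xs → u ∈ xs
  in-tail ne (here e)   = contradiction e ne
  in-tail ne (there u∈) = u∈
  free≢ : ∀ {v} → Adj G x v → free ≢ c v
  free≢ a refl = free∉ (∈-map⁺ c (∈-neighbours G a))
  proper' : ∀ {u v} → u ∈ x ∷ xs → v ∈ x ∷ xs → Adj G u v → (c [ x ≔ free ]) u ≢ (c [ x ≔ free ]) v
  proper' {u} {v} u∈ v∈ a e with u ≟ x | v ≟ x
  ... | yes refl | yes refl = irrefl G a
  ... | yes refl | no v≢x = free≢ a (trans (≡-sym (≔-same c u)) (trans e (≔-other c v≢x)))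
  ... | no u≢x | yes refl = free≢ (sym G a)
                              (trans (≡-sym (≔-same c v)) (trans (≡-sym e) (≔-other c u≢x)))
  ... | no u≢x | no v≢x = proper (in-tail u≢x u∈) (in-tail v≢x v∈) a
                              (trans (≡-sym (≔-other c u≢x)) (trans e (≔-other c v≢x)))

chromatic≤suc-maxDegree : ∀ {n} (G : Graph n) {χ} → IsChromaticNumber G χ → χ ≤ suc (maxDegree G)
chromatic≤suc-maxDegree G {χ} (_ , minimal) with χ ≤? suc (maxDegree G)
... | yes le = le
... | no ¬le with greedy-on G (allFin _)
... | c , proper = contradiction (c , λ u v → proper (∈-allFin u) (∈-allFin v)) (minimal _ (≰⇒> ¬le))

class : ∀ {n m} → (Fin n → Fin m) → Fin m → List (Fin n)
class c i = filter (λ v → c v ≟ i) (allFin _)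

∈-class : ∀ {n m} (c : Fin n → Fin m) {v i} → c v ≡ i → v ∈ class c i
∈-class c {v} e = ∈-filter⁺ (λ v → c v ≟ _) (∈-allFin v) e

∈-class⁻ : ∀ {n m} (c : Fin n → Fin m) {v i} → v ∈ class c i → c v ≡ i
∈-class⁻ c v∈ = proj₂ (∈-filter⁻ (λ v → c v ≟ _) {xs = allFin _} v∈)

class-unique : ∀ {n m} (c : Fin n → Fin m) i → Unique (class c i)
class-unique c i = filter⁺ (λ v → c v ≟ i) (allFin⁺ _)

size : ∀ {n m} → (Fin n → Fin m) → Fin m → ℕ
size c i = length (class c i)

module _ {n m : ℕ} (c : Fin n → Fin m) (v : Fin n) (i : Fin m) (cv≢i : c v ≢ i) where

  private c' = c [ v ≔ i ]

  size-recolour-target : size c i < size c' i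
  size-recolour-target = unique-⊆-length {xs = v ∷ class c i}
    (All.tabulate (λ { x∈ refl → cv≢i (∈-class⁻ c x∈) }) ∷ class-unique c i)
    λ { (here refl) → ∈-class c' (≔-same c v)
      ; (there x∈) → ∈-class c' (trans (≔-other c (λ { refl → cv≢i (∈-class⁻ c x∈) })) (∈-class⁻ c x∈)) }

  size-recolour-source : size c (c v) ≤ suc (size c' (c v))
  size-recolour-source = unique-⊆-length {ys = v ∷ class c' (c v)} (class-unique c (c v)) into
    where
    into : ∀ {x} → x ∈ class c (c v) → x ∈ v ∷ class c' (c v)
    into {x} x∈ with x ≟ v
    ... | yes refl = here refl
    ... | no x≢v = there (∈-class c' (trans (≔-other c x≢v) (∈-class⁻ c x∈)))

  size-recolour-other : ∀ {j} → j ≢ c v → size c j ≤ size c' j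
  size-recolour-other {j} j≢ = unique-⊆-length (class-unique c j)
    λ x∈ → ∈-class c' (trans (≔-other c (λ { refl → j≢ (≡-sym (∈-class⁻ c x∈)) })) (∈-class⁻ c x∈))

module _ {n : ℕ} (G : Graph n) where

  private Δ = maxDegree G

  -- For Δ = 0 the degree bound yields only n > 3, so `12 < n` is used; for Δ = d + 1 it reads 12 +
  -- 9d < n, which exceeds the required 10 + 5d < n.
  5*suc[Δ]<n : 9 * Δ + 3 < n → 12 < n → suc Δ * 5 < n
  5*suc[Δ]<n lt 12<n = go Δ lt
    where
    go : ∀ d → 9 * d + 3 < n → suc d * 5 < n
    go zero    _ = <-trans (s≤s (m≤m+n 5 6)) 12<n
    go (suc d) p = ≤-<-trans (+-mono-≤ (m≤m+n 10 2) (*-monoʳ-≤ d (m≤m+n 5 4))) (subst (_< n) (eq d) p)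
      where
      eq : ∀ d → 9 * suc d + 3 ≡ 12 + d * 9
      eq = solve 1 (λ d → con 9 :* (con 1 :+ d) :+ con 3 := con 12 :+ d :* con 9) refl

  -- If no vertex qualified, every vertex would be a neighbour of class i₀ or lie in a class of
  -- size at most 5 other than j₀, which accounts for at most 4Δ + 5Δ vertices.
  ∃-recolourable : ∀ {m} (c : Fin n → Fin m) → m ≤ suc Δ → 9 * Δ + 3 < n → 12 < n →
    ∀ i₀ → size c i₀ < 5 → ∃[ v ] 5 < size c (c v) × (∀ a → c a ≡ i₀ → ¬ Adj G v a)
  ∃-recolourable {suc m} c m≤Δ lt 12<n i₀ small
    with any? (λ v → (5 <? size c (c v)) ×-dec all? (λ a → (c a ≟ i₀) →-dec ¬? (adj? G v a)))
       | any? (λ j → 5 <? size c j)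
  ... | yes r | _ = r
  -- Without an oversized class, at most Δ + 1 classes of at most 5 vertices would cover the graph.
  ... | no none | no all-small = contradiction (begin
      n                                                    ≤⟨ covering-length _ covered ⟩
      length (concatMap (class c) (allFin (suc m)))        ≤⟨ length-concatMap-≤ (class c) 5 all≤5 (allFin (suc m)) ⟩
      length (allFin (suc m)) * 5                          ≡⟨ cong (_* 5) (length-allFin (suc m)) ⟩
      suc m * 5                                            ≤⟨ *-monoˡ-≤ 5 m≤Δ ⟩
      suc Δ * 5                                            ∎) (<⇒≱ (5*suc[Δ]<n lt 12<n))
    where
    open ≤-Reasoning
    all≤5 : ∀ j → size c j ≤ 5
    all≤5 j = ≮⇒≥ (λ p → all-small (j , p))
    covered : ∀ v → v ∈ concatMap (class c) (allFin (suc m))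
    covered v = ∈-concatMap⁺ (class c) (Any.map (λ { refl → ∈-class c refl }) (∈-allFin (c v)))
  ... | no none | yes (j₀ , big) = contradiction (begin
      n                                                       ≤⟨ covering-length _ covered ⟩
      length (near ++ concatMap smallClass others)            ≡⟨ length-++ near ⟩
      length near + length (concatMap smallClass others)      ≤⟨ +-mono-≤ near≤ others≤ ⟩
      4 * Δ + Δ * 5                                           ≡⟨ 4Δ+5Δ≡9Δ Δ ⟩
      9 * Δ                                                   ≤⟨ m≤m+n (9 * Δ) 3 ⟩
      9 * Δ + 3                                               ∎) (<⇒≱ lt)
    where
    open ≤-Reasoning
    4Δ+5Δ≡9Δ : ∀ d → 4 * d + d * 5 ≡ 9 * d
    4Δ+5Δ≡9Δ = solve 1 (λ d → con 4 :* d :+ d :* con 5 := con 9 :* d) refl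
    near : List (Fin n)
    near = concatMap (neighbours G) (class c i₀)
    near≤ : length near ≤ 4 * Δ
    near≤ = ≤-trans (length-concatMap-≤ (neighbours G) Δ (degree≤maxDegree G) (class c i₀))
                    (*-monoˡ-≤ Δ (≤-pred small))
    smallClass : Fin (suc m) → List (Fin n)
    smallClass j with 5 <? size c j
    ... | yes _ = []
    ... | no  _ = class c j
    smallClass≤ : ∀ j → length (smallClass j) ≤ 5
    smallClass≤ j with 5 <? size c j
    ... | yes _ = z≤n
    ... | no ≮ = ≮⇒≥ ≮
    -- Omitting the oversized class `j₀` leaves at most Δ classes, hence 5Δ rather than 5(Δ + 1).
    others : List (Fin (suc m))
    others = map (punchIn j₀) (allFin m)
    others≤ : length (concatMap smallClass others) ≤ Δ * 5
    others≤ = ≤-trans (length-concatMap-≤ smallClass 5 smallClass≤ others)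
      (*-monoˡ-≤ 5 (≤-trans (≤-reflexive (trans (length-map (punchIn j₀) (allFin m)) (length-allFin m)))
                            (≤-pred m≤Δ)))
    ∈-smallClass : ∀ v → ¬ 5 < size c (c v) → v ∈ smallClass (c v)
    ∈-smallClass v ≮ with 5 <? size c (c v)
    ... | yes p = contradiction p ≮
    ... | no  _ = ∈-class c refl
    covered : ∀ v → v ∈ near ++ concatMap smallClass others
    covered v with 5 <? size c (c v)
    ... | yes 5< = ∈-++⁺ˡ (∈-concatMap⁺ (neighbours G) near-i₀)
      where
      near-i₀ : Any (λ a → v ∈ neighbours G a) (class c i₀)
      near-i₀ with any? (λ a → (c a ≟ i₀) ×-dec adj? G v a)
      ... | yes (a , ca , va) = Any.map (λ { refl → ∈-neighbours G (sym G va) }) (∈-class c ca)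
      ... | no ¬a = contradiction (v , 5< , λ a ca va → ¬a (a , ca , va)) none
    ... | no ≮ = ∈-++⁺ʳ near (∈-concatMap⁺ smallClass
                   (Any.map (λ { refl → ∈-smallClass v ≮ }) other))
      where
      j₀≢ : j₀ ≢ c v
      j₀≢ refl = ≮ big
      other : c v ∈ others
      other = subst (_∈ others) (punchIn-punchOut j₀≢)
                (∈-map⁺ (punchIn j₀) (∈-allFin (punchOut j₀≢)))

  deficiency : ∀ {m} → (Fin n → Fin m) → ℕ
  deficiency c = sum (map (λ i → 5 ∸ size c i) (allFin _))

  -- A move enlarges the too small class `i₀`, whose term in `deficiency` drops. The source class
  -- had more than 5 vertices, so it keeps 5 and its truncated term stays 0.
  enlarge-classes : ∀ {m} → m ≤ suc Δ → 9 * Δ + 3 < n → 12 < n →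
    ∀ (c : Fin n → Fin m) → ProperColouring G m c → Acc _<_ (deficiency c) →
    Σ (Colourable G m) λ c → ∀ i → 5 ≤ size (proj₁ c) i
  enlarge-classes {m} m≤Δ lt 12<n c proper (acc rec) with all? (λ i → 5 ≤? size c i)
  ... | yes large = (c , proper) , large
  ... | no ¬large with ¬∀⟶∃¬ m (λ i → 5 ≤ size c i) (λ i → 5 ≤? size c i) ¬large
  ... | i₀ , ¬5≤ with ∃-recolourable c m≤Δ lt 12<n i₀ (≰⇒> ¬5≤)
  ... | v , 5< , free = enlarge-classes m≤Δ lt 12<n c' proper'
          (rec (sum-map-strict (λ i → 5 ∸ size c' i) (λ i → 5 ∸ size c i) weak strict (∈-allFin i₀)))
    where
    c' = c [ v ≔ i₀ ]
    cv≢i₀ : c v ≢ i₀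
    cv≢i₀ e = ¬5≤ (subst (λ i → 5 ≤ size c i) e (<⇒≤ 5<))
    strict : 5 ∸ size c' i₀ < 5 ∸ size c i₀
    strict = ≤-<-trans (∸-monoʳ-≤ 5 (size-recolour-target c v i₀ cv≢i₀)) (∸-monoʳ-< ≤-refl (≰⇒> ¬5≤))
    weak : ∀ i → 5 ∸ size c' i ≤ 5 ∸ size c i
    weak i with i ≟ c v
    ... | no i≢ = ∸-monoʳ-≤ 5 (size-recolour-other c v i₀ cv≢i₀ i≢)
    ... | yes refl = ≤-trans (≤-reflexive (m≤n⇒m∸n≡0
                       (≤-pred (≤-trans 5< (size-recolour-source c v i₀ cv≢i₀))))) z≤n
    proper' : ProperColouring G m c'
    proper' a b ab e with a ≟ v | b ≟ v
    ... | yes refl | yes refl = irrefl G ab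
    ... | yes refl | no b≢ = free b (trans (≡-sym (≔-other c b≢)) (trans (≡-sym e) (≔-same c v))) ab
    ... | no a≢ | yes refl = free a (trans (≡-sym (≔-other c a≢)) (trans e (≔-same c v))) (sym G ab)
    ... | no a≢ | no b≢ = proper a b ab (trans (≡-sym (≔-other c a≢)) (trans e (≔-other c b≢)))

-- Every nonempty class has at least m vertices.
LargeClasses : ∀ {n k} → ℕ → (Fin n → Fin k) → Set
LargeClasses m c = ∀ u xs → length xs < m → ∃[ a ] a ∉ xs × c a ≡ c u

LargeClasses-mono : ∀ {n k l m} {c : Fin n → Fin k} → l ≤ m → LargeClasses m c → LargeClasses l c
LargeClasses-mono l≤m large u xs lt = large u xs (≤-trans lt l≤m)

size⇒LargeClasses : ∀ {n k m} (c : Fin n → Fin k) → (∀ i → m ≤ size c i) → LargeClasses m c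
size⇒LargeClasses c large u xs lt
  with ∃-outside xs (class c (c u)) (class-unique c (c u)) (≤-trans lt (large (c u)))
... | a , a∉ , a∈ = a , a∉ , ∈-class⁻ c a∈

large-chromatic-colouring : ∀ {n} (G : Graph n) → 9 * maxDegree G + 3 < n → 12 < n →
  ∀ {χ} → IsChromaticNumber G χ → Σ (Colourable G χ) λ c → LargeClasses 5 (proj₁ c)
large-chromatic-colouring G lt 12<n isχ@((c , proper) , _)
  with enlarge-classes G (chromatic≤suc-maxDegree G isχ) lt 12<n c proper (<-wellFounded _)
... | c' , large = c' , size⇒LargeClasses (proj₁ c') large

-- One edge gives Δ ≥ 1, and then the degree bound forces n > 12.
edgeless : ∀ {n} (G : Graph n) → 9 * maxDegree G + 3 < n → ¬ 12 < n → ∀ u v → ¬ Adj G u v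
edgeless {n} G lt ≮ u v a = ≮ (≤-<-trans (begin
    12                    ≤⟨ +-monoˡ-≤ 3 (*-monoʳ-≤ 9 {1} {maxDegree G} 1≤Δ) ⟩
    9 * maxDegree G + 3   ∎) lt)
  where
  open ≤-Reasoning
  1≤Δ : 1 ≤ maxDegree G
  1≤Δ = ≤-trans (unique-⊆-length ([] ∷ []) λ { (here refl) → ∈-neighbours G a }) (degree≤maxDegree G u)

chromatic-colouring-4 : ∀ {n} (G : Graph n) → 9 * maxDegree G + 3 < n →
  ∀ {χ} → IsChromaticNumber G χ → Σ (Colourable G χ) λ c → LargeClasses 4 (proj₁ c)
chromatic-colouring-4 {n} G lt isχ with 12 <? n
... | yes 12<n with large-chromatic-colouring G lt 12<n isχ
...   | c , large = c , LargeClasses-mono {c = proj₁ c} (n≤1+n 4) large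
-- Without edges a single colour is proper, and `c fzero` merely supplies one. The degree bound
-- gives only n ≥ 4 here, so 4 is the best class size available.
chromatic-colouring-4 {suc n} G lt ((c , _) , _) | no ≮ =
  (const (c fzero) , λ u v a → contradiction a (edgeless G lt ≮ u v)) , large
  where
  4≤n : 4 ≤ suc n
  4≤n = ≤-trans (s≤s (m≤n+m 3 (9 * maxDegree G))) lt
  large : LargeClasses 4 (const (c fzero))
  large u xs len with ∃-outside xs (allFin (suc n)) (allFin⁺ _)
                        (≤-trans len (≤-trans 4≤n (≤-reflexive (≡-sym (length-allFin (suc n))))))
  ... | a , a∉ , _ = a , a∉ , refl

-- Partitions and moves

clash : ∀ {b} {A : Set} → b ≡ true → b ≡ false → A
clash refl ()

≡-from-⇔ : ∀ {x y} → (x ≡ true → y ≡ true) → (y ≡ true → x ≡ true) → x ≡ y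
≡-from-⇔ {true}          f g = ≡-sym (f refl)
≡-from-⇔ {false} {true}  f g = g refl
≡-from-⇔ {false} {false} f g = refl

¬true⇒false : ∀ {x} → ¬ x ≡ true → x ≡ false
¬true⇒false {true}  ne = contradiction refl ne
¬true⇒false {false} ne = refl

module _ {n : ℕ} {G : Graph n} {k : ℕ} where

  rel : BellVertex G k → Fin n → Fin n → Bool
  rel S = same (proj₁ S)

  col : BellVertex G k → Fin n → Fin k
  col S = proj₁ (proj₂ S)

  -- Records rather than abbreviations, so that the partitions can be inferred from the proofs.
  record _≈_ (S T : BellVertex G k) : Set where
    constructor agree
    field rel≡ : proj₁ S ≈P proj₁ T
  open _≈_ public

  record Off (x : Fin n) (S T : BellVertex G k) : Set where
    constructor agreeOff
    field off : AgreeOff x (proj₁ S) (proj₁ T)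
  open Off public

  -- Adjacency in the Bell graph or, when the graph has a vertex, equality.
  Close : BellVertex G k → BellVertex G k → Set
  Close S T = ∃[ x ] Off x S T

  col⇒rel : ∀ S {u v} → col S u ≡ col S v → rel S u v ≡ true
  col⇒rel S {u} {v} = proj₁ (proj₂ (proj₂ S) u v)

  rel⇒col : ∀ S {u v} → rel S u v ≡ true → col S u ≡ col S v
  rel⇒col S {u} {v} = proj₂ (proj₂ (proj₂ S) u v)

  col≢⇒rel : ∀ S {u v} → col S u ≢ col S v → rel S u v ≡ false
  col≢⇒rel S ne = ¬true⇒false (ne ∘ rel⇒col S)

  rel-refl : ∀ S u → rel S u u ≡ true
  rel-refl S = same-refl (proj₁ S)

  rel-comm : ∀ S u v → rel S u v ≡ rel S v u
  rel-comm S u v = ≡-from-⇔ (same-sym (proj₁ S) u v) (same-sym (proj₁ S) v u)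

  rel-cong : ∀ S {u v} → rel S u v ≡ true → ∀ t → rel S u t ≡ rel S v t
  rel-cong S {u} {v} e t =
    ≡-from-⇔ (same-trans (proj₁ S) v u t (trans (rel-comm S v u) e)) (same-trans (proj₁ S) u v t e)

  rel-nonadj : ∀ S {u v} → rel S u v ≡ true → ¬ Adj G u v
  rel-nonadj S {u} {v} = independent (proj₁ S) u v

  adj-rel : ∀ S {u v} → Adj G u v → rel S u v ≡ false
  adj-rel S a = ¬true⇒false (λ e → rel-nonadj S e a)

  ≈-sym : ∀ {S T} → S ≈ T → T ≈ S
  ≈-sym e = agree λ u v → ≡-sym (rel≡ e u v)

  ≈-trans : ∀ {S T U} → S ≈ T → T ≈ U → S ≈ U
  ≈-trans e f = agree λ u v → trans (rel≡ e u v) (rel≡ f u v)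

  _≈?_ : ∀ S T → Dec (S ≈ T)
  S ≈? T = map′ agree rel≡ (all? λ u → all? λ v → rel S u v Bool.≟ rel T u v)

  ≈⇒off : ∀ {x S T} → S ≈ T → Off x S T
  ≈⇒off e = agreeOff λ u v _ _ → rel≡ e u v

  off-refl : ∀ {x S} → Off x S S
  off-refl = agreeOff λ _ _ _ _ → refl

  off-sym : ∀ {x S T} → Off x S T → Off x T S
  off-sym o = agreeOff λ u v p q → ≡-sym (off o u v p q)

  off-trans : ∀ {x S T U} → Off x S T → Off x T U → Off x S U
  off-trans o o' = agreeOff λ u v p q → trans (off o u v p q) (off o' u v p q)

  close-sym : ∀ {S T} → Close S T → Close T S
  close-sym (x , o) = x , off-sym o

  close-resp-≈ : ∀ {S S' T T'} → S ≈ S' → T ≈ T' → Close S T → Close S' T'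
  close-resp-≈ e f (x , o) = x , off-trans (≈⇒off (≈-sym e)) (off-trans o (≈⇒off f))

  off-≉ : ∀ {x S T U} → Off x S T → ¬ Close S U → ¬ T ≈ U
  off-≉ {x} o ¬cl e = ¬cl (x , off-trans o (≈⇒off e))

  off-by-row : ∀ {x y S T} →
    (∀ a b → a ≢ x → a ≢ y → b ≢ x → b ≢ y → rel S a b ≡ rel T a b) →
    (∀ t → t ≢ x → t ≢ y → rel S x t ≡ rel T x t) → Off y S T
  off-by-row {x} {y} {S} {T} rest row = agreeOff go
    where
    go : ∀ a b → a ≢ y → b ≢ y → rel S a b ≡ rel T a b
    go a b a≢y b≢y with a ≟ x | b ≟ x
    ... | yes refl | yes refl = trans (rel-refl S x) (≡-sym (rel-refl T x))
    ... | yes refl | no b≢x = row b b≢x b≢y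
    ... | no a≢x | yes refl = trans (rel-comm S a x) (trans (row a a≢x a≢y) (rel-comm T x a))
    ... | no a≢x | no b≢x = rest a b a≢x a≢y b≢x b≢y

  off-move : ∀ {x y S T} → Off x S T → (∀ t → t ≢ x → t ≢ y → rel S x t ≡ rel T x t) → Off y S T
  off-move o row = off-by-row (λ a b p _ q _ → off o a b p q) row

  off⇒≈ : ∀ {x S T} → Off x S T → (∀ t → t ≢ x → rel S x t ≡ rel T x t) → S ≈ T
  off⇒≈ {x} {S} {T} o row = agree go
    where
    go : ∀ a b → rel S a b ≡ rel T a b
    go a b with a ≟ x | b ≟ x
    ... | yes refl | yes refl = trans (rel-refl S x) (≡-sym (rel-refl T x))
    ... | yes refl | no b≢x = row b b≢x
    ... | no a≢x | yes refl = trans (rel-comm S a x) (trans (row a a≢x) (rel-comm T x a))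
    ... | no a≢x | no b≢x = off o a b a≢x b≢x

  -- A single mate of `x` fixes the whole part of `x`, and everything else is fixed by agreement off
  -- `x`.
  common-mate⇒≈ : ∀ {x a S T} → Off x S T → a ≢ x → rel S x a ≡ true → rel T x a ≡ true → S ≈ T
  common-mate⇒≈ {x} {a} {S} {T} o a≢x e f = off⇒≈ o λ t t≢x →
    trans (rel-cong S e t) (trans (off o a t a≢x t≢x) (≡-sym (rel-cong T f t)))

  moved : ∀ {x a S T} → Off x S T → ¬ S ≈ T → a ≢ x → rel S x a ≡ true → rel T x a ≡ false
  moved o ne a≢x e = ¬true⇒false λ f → ne (common-mate⇒≈ o a≢x e f)

  fromColouring : (c : Fin n → Fin k) → ProperColouring G k c → BellVertex G k
  fromColouring c proper = record
    { same        = λ u v → does (c u ≟ c v)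
    ; same-refl   = λ u → dec-true (c u ≟ c u) refl
    ; same-sym    = λ u v e → into v u (≡-sym (out u v e))
    ; same-trans  = λ u v w e f → into u w (trans (out u v e) (out v w f))
    ; independent = λ u v e a → proper u v a (out u v e)
    } , c , λ u v → into u v , out u v
    where
    into : ∀ u v → c u ≡ c v → does (c u ≟ c v) ≡ true
    into u v = dec-true (c u ≟ c v)
    out : ∀ u v → does (c u ≟ c v) ≡ true → c u ≡ c v
    out u v e with c u ≟ c v
    ... | yes p = p
    out u v () | no _

  module Recolour (S : BellVertex G k) (u : Fin n) (x : Fin k)
                  (allowed : ∀ t → t ≢ u → x ≡ col S t → ¬ Adj G u t) where

    private
      c : Fin n → Fin k
      c = col S [ u ≔ x ]

      proper : ProperColouring G k c
      proper a b ab e with a ≟ u | b ≟ u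
      ... | yes refl | yes refl = irrefl G ab
      ... | yes refl | no b≢ =
        allowed b b≢ (trans (≡-sym (≔-same (col S) u)) (trans e (≔-other (col S) b≢))) ab
      ... | no a≢ | yes refl =
        allowed a a≢ (trans (≡-sym (≔-same (col S) u)) (trans (≡-sym e) (≔-other (col S) a≢))) (sym G ab)
      ... | no a≢ | no b≢ = rel-nonadj S
        (col⇒rel S (trans (≡-sym (≔-other (col S) a≢)) (trans e (≔-other (col S) b≢)))) ab

    recoloured : BellVertex G k
    recoloured = fromColouring c proper

    recolour-off : Off u S recoloured
    recolour-off = agreeOff λ a b a≢ b≢ → ≡-from-⇔
      (λ e → col⇒rel recoloured (trans (≔-other (col S) a≢)
               (trans (rel⇒col S e) (≡-sym (≔-other (col S) b≢)))))
      (λ e → col⇒rel S (trans (≡-sym (≔-other (col S) a≢))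
               (trans (rel⇒col recoloured e) (≔-other (col S) b≢))))

    recolour-joins : ∀ {t} → t ≢ u → x ≡ col S t → rel recoloured u t ≡ true
    recolour-joins t≢ e = col⇒rel recoloured
      (trans (≔-same (col S) u) (trans e (≡-sym (≔-other (col S) t≢))))

    recolour-avoids : ∀ {t} → t ≢ u → x ≢ col S t → rel recoloured u t ≡ false
    recolour-avoids t≢ ne = col≢⇒rel recoloured λ e →
      ne (trans (≡-sym (≔-same (col S) u)) (trans e (≔-other (col S) t≢)))

  open Recolour using (recoloured; recolour-off; recolour-joins; recolour-avoids) public

  -- Neighbours that move the same vertex are always close, so this makes the neighbourhood of `S` a
  -- disjoint union of cliques, one for each vertex that can be moved.
  Separated : BellVertex G k → Set
  Separated S = ∀ {A B a b} → Off a S A → ¬ S ≈ A → Off b S B → ¬ S ≈ B → Close A B → a ≡ b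

  -- The part of s has at least four vertices.
  HasMates : BellVertex G k → Fin n → Set
  HasMates S s = ∀ t r → ∃[ a ] a ≢ s × a ≢ t × a ≢ r × rel S s a ≡ true

  private
    -- Suppose that `A` and `B` agree off `r`. If r ≠ s, a mate of `s` other than `t` and `r` stays
    -- with `s` in `B` and hence in `A`, although `A` has moved `s`. If r = s, then `B` agrees with
    -- `S` off `s` as well as off `t`, and a mate of `s` settles whether `s` and `t` are together,
    -- so that `B` equals `S`.
    separated-at : ∀ {S A B s t} → HasMates S s →
      Off s S A → ¬ S ≈ A → Off t S B → ¬ S ≈ B → s ≢ t → ¬ Close A B
    separated-at {S} {A} {B} {s} {t} mates oA nA oB nB s≢t (r , o) with r ≟ s
    ... | no r≢s with mates t r
    ...   | a , a≢s , a≢t , a≢r , e =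
      clash (trans (off o s a (≢-sym r≢s) a≢r) (trans (≡-sym (off oB s a s≢t a≢t)) e))
            (moved oA nA a≢s e)
    separated-at {S} {A} {B} {s} {t} mates oA nA oB nB s≢t (r , o) | yes refl with mates t t
    ... | a , a≢s , a≢t , _ , e = nB (off⇒≈ oB row)
      where
      oS : Off s S B
      oS = off-trans oA o
      row : ∀ w → w ≢ t → rel S t w ≡ rel B t w
      row w w≢t with w ≟ s
      ... | no w≢s = off oS t w (≢-sym s≢t) w≢s
      ... | yes refl =
        trans (rel-comm S t s) (trans (rel-cong S e t) (trans (off oS a t a≢s (≢-sym s≢t))
          (trans (≡-sym (rel-cong B (trans (≡-sym (off oB s a s≢t a≢t)) e) t)) (rel-comm B s t))))

  -- Mates are asked of only one of two vertices so as to include the partitions in which one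
  -- isolated vertex has none.
  separated : ∀ S → (∀ s t → s ≢ t → HasMates S s ⊎ HasMates S t) → Separated S
  separated S mates {a = a} {b} oA nA oB nB cl with a ≟ b
  ... | yes e = e
  ... | no a≢b with mates a b a≢b
  ...   | inj₁ m = contradiction cl (separated-at m oA nA oB nB a≢b)
  ...   | inj₂ m = contradiction (close-sym cl) (separated-at m oB nB oA nA (≢-sym a≢b))

  -- Common neighbours of two moved partitions

  private
    amalgam₁ : ∀ {P Q R u v} → Off u P Q → Off v P R → u ≢ v → ¬ Adj G u v →
      ∀ {t} → t ≢ u → t ≢ v → rel Q u t ≡ true → ∃[ X ] Off v Q X × Off u R X
    amalgam₁ {P} {Q} {R} {u} {v} oQ oR u≢v ¬uv {t} t≢u t≢v e =
      X , off-by-row rest row , recolour-off R u (col R t) allowed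
      where
      Q≡R : ∀ a b → a ≢ u → a ≢ v → b ≢ u → b ≢ v → rel Q a b ≡ rel R a b
      Q≡R a b a≢u a≢v b≢u b≢v = trans (≡-sym (off oQ a b a≢u b≢u)) (off oR a b a≢v b≢v)
      u-row : ∀ w → w ≢ u → w ≢ v → rel Q u w ≡ rel R t w
      u-row w w≢u w≢v = trans (rel-cong Q e w) (Q≡R t w t≢u t≢v w≢u w≢v)
      allowed : ∀ w → w ≢ u → col R t ≡ col R w → ¬ Adj G u w
      allowed w w≢u tw with w ≟ v
      ... | yes refl = ¬uv
      ... | no w≢v = rel-nonadj Q (trans (u-row w w≢u w≢v) (col⇒rel R tw))
      X : BellVertex G k
      X = recoloured R u (col R t) allowed
      R≡X : Off u R X
      R≡X = recolour-off R u (col R t) allowed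
      rest : ∀ a b → a ≢ u → a ≢ v → b ≢ u → b ≢ v → rel Q a b ≡ rel X a b
      rest a b a≢u a≢v b≢u b≢v = trans (Q≡R a b a≢u a≢v b≢u b≢v) (off R≡X a b a≢u b≢u)
      row : ∀ w → w ≢ u → w ≢ v → rel Q u w ≡ rel X u w
      row w w≢u w≢v = trans (u-row w w≢u w≢v) (trans (off R≡X t w t≢u w≢u)
        (≡-sym (rel-cong X (recolour-joins R u (col R t) allowed t≢u refl) w)))

  -- `X` makes both moves at once: if `u` has in `Q` a mate other than `v`, then `u` follows this
  -- mate in `R`, and symmetrically for `v`.
  amalgam : ∀ {P Q R u v} → Off u P Q → Off v P R → u ≢ v → ¬ Adj G u v →
            ∃[ X ] Off v Q X × Off u R X
  amalgam {P} {Q} {R} {u} {v} oQ oR u≢v ¬uv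
    with any? (λ t → ¬? (t ≟ u) ×-dec ¬? (t ≟ v) ×-dec (rel Q u t Bool.≟ true))
       | any? (λ t → ¬? (t ≟ v) ×-dec ¬? (t ≟ u) ×-dec (rel R v t Bool.≟ true))
  ... | yes (t , t≢u , t≢v , e) | _ = amalgam₁ oQ oR u≢v ¬uv t≢u t≢v e
  ... | no _ | yes (t , t≢v , t≢u , e) with amalgam₁ oR oQ (≢-sym u≢v) (¬uv ∘ sym G) t≢v t≢u e
  ...   | X , oRX , oQX = X , oQX , oRX
  -- Neither vertex has a mate except possibly the other. Two singletons might need more than `k`
  -- parts, so `u` and `v` share one, which is independent as they are non-adjacent.
  amalgam {P} {Q} {R} {u} {v} oQ oR u≢v ¬uv | no ¬t | no ¬s = X , oX , off-by-row rest row
    where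
    allowed : ∀ t → t ≢ v → col Q u ≡ col Q t → ¬ Adj G v t
    allowed t t≢v e with t ≟ u
    ... | yes refl = ¬uv ∘ sym G
    ... | no t≢u = contradiction (t , t≢u , t≢v , col⇒rel Q e) ¬t
    X : BellVertex G k
    X = recoloured Q v (col Q u) allowed
    oX : Off v Q X
    oX = recolour-off Q v (col Q u) allowed
    rest : ∀ a b → a ≢ v → a ≢ u → b ≢ v → b ≢ u → rel R a b ≡ rel X a b
    rest a b a≢v a≢u b≢v b≢u =
      trans (≡-sym (off oR a b a≢v b≢v)) (trans (off oQ a b a≢u b≢u) (off oX a b a≢v b≢v))
    row : ∀ t → t ≢ v → t ≢ u → rel R v t ≡ rel X v t
    row t t≢v t≢u = trans (¬true⇒false (λ e → ¬s (t , t≢v , t≢u , e)))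
      (≡-sym (recolour-avoids Q v (col Q u) allowed t≢v (λ e → ¬t (t , t≢u , t≢v , col⇒rel Q e))))

  -- If the amalgam were `P` itself, `Q` would arise from `P` by moving `v` as well as by moving
  -- `u`, against separatedness.
  non-adjacent⇒common-neighbour : ∀ {P Q R u v} → Separated P →
    Off u P Q → ¬ P ≈ Q → Off v P R → u ≢ v → ¬ Adj G u v →
    ∃[ X ] Close Q X × Close R X × ¬ P ≈ X
  non-adjacent⇒common-neighbour {u = u} sep oQ nQ oR u≢v ¬uv with amalgam oQ oR u≢v ¬uv
  ... | X , oQX , oRX = X , (_ , oQX) , (_ , oRX) , λ P≈X →
    u≢v (sep oQ nQ (off-trans (≈⇒off P≈X) (off-sym oQX)) nQ (u , off-refl))

omit-colour : ∀ {n m} (G : Graph n) (d : Fin n → Fin (suc m)) → ProperColouring G (suc m) d →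
  ∀ p (p≢ : ∀ a → p ≢ d a) → ProperColouring G m (λ a → punchOut (p≢ a))
omit-colour G d proper p p≢ a b ab e = proper a b ab (punchOut-injective (p≢ a) (p≢ b) e)

omit-two-colours : ∀ {n k} (G : Graph n) (d : Fin n → Fin k) → ProperColouring G k d →
  ∀ p q → p ≢ q → (∀ a → p ≢ d a) → (∀ a → q ≢ d a) → ∃[ m ] k ≡ suc (suc m) × Colourable G m
omit-two-colours {k = suc zero} G d proper fzero fzero p≢q _ _ = contradiction refl p≢q
omit-two-colours {k = suc (suc m)} G d proper p q p≢q p≢ q≢ =
  m , refl , (λ a → punchOut (q'≢ a)) ,
  omit-colour G _ (omit-colour G d proper p p≢) (punchOut p≢q) q'≢
  where
  q'≢ : ∀ a → punchOut p≢q ≢ punchOut (p≢ a)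
  q'≢ a e = q≢ a (punchOut-injective p≢q (p≢ a) e)

module _ {n : ℕ} {G : Graph n} {k : ℕ} where

  -- Both colours col S u and col S v become unused when u and v join s and t.
  two-singletons⇒colourable : ∀ (S P : BellVertex G k) {u v} → u ≢ v →
    (∀ a b → a ≢ u → a ≢ v → b ≢ u → b ≢ v → rel P a b ≡ rel S a b) →
    (∀ t → t ≢ u → rel S u t ≡ false) → (∀ t → t ≢ v → rel S v t ≡ false) →
    ∀ {s} → s ≢ u → s ≢ v → rel P u s ≡ true → ∀ {t} → t ≢ u → t ≢ v → rel P v t ≡ true →
    ∃[ m ] k ≡ suc (suc m) × Colourable G m
  two-singletons⇒colourable S P {u} {v} u≢v P≡S u-alone v-alone {s} s≢u s≢v us {t} t≢u t≢v vt =
    omit-two-colours G (λ a → col S (rep a)) proper (col S u) (col S v)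
      (λ e → clash (col⇒rel S e) (u-alone v (≢-sym u≢v)))
      (λ a e → clash (col⇒rel S e) (u-alone (rep a) (rep≢u a)))
      (λ a e → clash (col⇒rel S e) (v-alone (rep a) (rep≢v a)))
    where
    rep : Fin n → Fin n
    rep a with a ≟ u | a ≟ v
    ... | yes _ | _     = s
    ... | no _  | yes _ = t
    ... | no _  | no _  = a
    rep≢u : ∀ a → rep a ≢ u
    rep≢u a with a ≟ u | a ≟ v
    ... | yes _ | _     = s≢u
    ... | no _  | yes _ = t≢u
    ... | no a≢u | no _ = a≢u
    rep≢v : ∀ a → rep a ≢ v
    rep≢v a with a ≟ u | a ≟ v
    ... | yes _ | _     = s≢v
    ... | no _  | yes _ = t≢v
    ... | no _ | no a≢v = a≢v
    rep-mate : ∀ a → rel P a (rep a) ≡ true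
    rep-mate a with a ≟ u | a ≟ v
    ... | yes refl | _     = us
    ... | no _  | yes refl = vt
    ... | no _  | no _  = rel-refl P a
    proper : ProperColouring G k (λ a → col S (rep a))
    proper a b ab e = rel-nonadj P
      (trans (rel-cong P (rep-mate a) b) (trans (rel-comm P (rep a) b) (trans (rel-cong P (rep-mate b) (rep a))
        (trans (P≡S (rep b) (rep a) (rep≢u b) (rep≢v b) (rep≢u a) (rep≢v a))
               (col⇒rel S (≡-sym e)))))) ab

module _ {n : ℕ} {G : Graph n} {k : ℕ} where

  -- Y isolates x, so separatedness of Q gives the part of x in Q at least four vertices. As R also
  -- isolates x, and Q and R agree off {u, v}, the vertex x must be u or v.
  private
    isolated-by-one : ∀ {P Q R X Y : BellVertex G k} {u v x y} →
      Separated Q → Off u P Q → Off v P R → x ≢ u → x ≢ y →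
      Off x Q X → Off x Q Y → Off y R X → Off y R Y → ¬ Q ≈ X → ¬ Q ≈ Y →
      rel X x y ≡ true → rel Y x y ≡ false →
      x ≡ v × (∀ t → t ≢ x → rel Y x t ≡ false) × ∃[ t ] t ≢ x × t ≢ y × rel Q x t ≡ true
    isolated-by-one {P} {Q} {R} {X} {Y} {u} {v} {x} {y}
        sep oPQ oPR x≢u x≢y oQX oQY oRX oRY Q≉X Q≉Y Xxy Yxy =
      x≡v , Y-alone , t₀ , t₀≢x , mate≢y Qxt₀ , Qxt₀
      where
      oXY : Off x X Y
      oXY = off-trans (off-sym oQX) oQY
      oXY' : Off y X Y
      oXY' = off-trans (off-sym oRX) oRY
      -- `X` and `Y` agree off `x` and off `y`. A mate of `x` in `Y` would be one in `X`, there also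
      -- a mate of `y`, and back in `Y` would put `x` and `y` together.
      Y-alone : ∀ t → t ≢ x → rel Y x t ≡ false
      Y-alone t t≢x with t ≟ y
      ... | yes refl = Yxy
      ... | no t≢y = ¬true⇒false λ e →
        let Xxt = trans (off oXY' x t x≢y t≢y) e
            Yyt = trans (≡-sym (off oXY y t (≢-sym x≢y) t≢x)) (trans (≡-sym (rel-cong X Xxy t)) Xxt)
        in clash (trans (rel-comm Y x y) (trans (rel-cong Y Yyt x) (trans (rel-comm Y t x) e))) Yxy
      R-alone : ∀ t → t ≢ x → t ≢ y → rel R x t ≡ false
      R-alone t t≢x t≢y = trans (off oRY x t x≢y t≢y) (Y-alone t t≢x)
      Qxy : rel Q x y ≡ false
      Qxy = ¬true⇒false λ e → Q≉X (common-mate⇒≈ oQX (≢-sym x≢y) e Xxy)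
      mate≢y : ∀ {t} → rel Q x t ≡ true → t ≢ y
      mate≢y e refl = clash e Qxy
      mate : ∃[ t ] t ≢ x × rel Q x t ≡ true
      mate with any? (λ t → ¬? (t ≟ x) ×-dec (rel Q x t Bool.≟ true))
      ... | yes r = r
      ... | no none = contradiction (off⇒≈ oQY λ t t≢x →
              trans (¬true⇒false (λ e → none (t , t≢x , e))) (≡-sym (Y-alone t t≢x))) Q≉Y
      t₀ = proj₁ mate
      t₀≢x = proj₁ (proj₂ mate)
      Qxt₀ = proj₂ (proj₂ mate)

      module _ (x≢v : x ≢ v) where

        -- Any other mate would stay with `x` from `Q` through `P` to `R`, where `x` has no mate but
        -- possibly `y`. So the part of `x` in `Q` has at most three vertices.
        mate∈uv : ∀ t → t ≢ x → rel Q x t ≡ true → t ≡ u ⊎ t ≡ v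
        mate∈uv t t≢x e with t ≟ u | t ≟ v
        ... | yes p | _ = inj₁ p
        ... | no _ | yes p = inj₂ p
        ... | no t≢u | no t≢v = clash
          (trans (≡-sym (off oPR x t x≢v t≢v)) (trans (off oPQ x t x≢u t≢u) e))
          (R-alone t t≢x (mate≢y e))

        no-third-mate : ∀ {t₁ t₂} → t₁ ≢ x → t₂ ≢ x → t₁ ≢ t₀ → t₂ ≢ t₀ → t₂ ≢ t₁ →
                        rel Q x t₁ ≡ true → rel Q x t₂ ≡ false
        no-third-mate {t₁} {t₂} n₁ n₂ n₁₀ n₂₀ n₂₁ e₁ = ¬true⇒false λ e₂ →
          pigeon (mate∈uv t₀ t₀≢x Qxt₀) (mate∈uv t₁ n₁ e₁) (mate∈uv t₂ n₂ e₂)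
          where
          pigeon : t₀ ≡ u ⊎ t₀ ≡ v → t₁ ≡ u ⊎ t₁ ≡ v → t₂ ≡ u ⊎ t₂ ≡ v → ⊥
          pigeon (inj₁ a) (inj₁ b) _ = n₁₀ (trans b (≡-sym a))
          pigeon (inj₂ a) (inj₂ b) _ = n₁₀ (trans b (≡-sym a))
          pigeon (inj₁ a) (inj₂ b) (inj₁ c) = n₂₀ (trans c (≡-sym a))
          pigeon (inj₁ a) (inj₂ b) (inj₂ c) = n₂₁ (trans c (≡-sym b))
          pigeon (inj₂ a) (inj₁ b) (inj₁ c) = n₂₁ (trans c (≡-sym b))
          pigeon (inj₂ a) (inj₁ b) (inj₂ c) = n₂₀ (trans c (≡-sym a))

        -- If the part of x in Q is {x, t₀} then isolating t₀ also gives Y.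
        two : (∀ t → t ≢ x → t ≢ t₀ → rel Q x t ≡ false) → ⊥
        two none = t₀≢x (sep (off-move oQY λ t t≢x t≢t₀ →
          trans (none t t≢x t≢t₀) (≡-sym (Y-alone t t≢x))) Q≉Y oQY Q≉Y (x , off-refl))

        -- If it is {x, t₀, t₁} then isolating t₀ gives a neighbour T of Q close to Y; Y lends it
        -- the colour that x gives up by rejoining t₁.
        three : ∀ t₁ → t₁ ≢ x → t₁ ≢ t₀ → rel Q x t₁ ≡ true → ⊥
        three t₁ t₁≢x t₁≢t₀ Qxt₁ = t₀≢x (sep oQT Q≉T oQY Q≉Y (t₁ , agreeOff T≡Y))
          where
          rejoin-allowed : ∀ t → t ≢ x → col Y t₁ ≡ col Y t → ¬ Adj G x t
          rejoin-allowed t t≢x e = rel-nonadj Q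
            (trans (rel-cong Q Qxt₁ t) (trans (off oQY t₁ t t₁≢x t≢x) (col⇒rel Y e)))
          Q' = recoloured Y x (col Y t₁) rejoin-allowed
          oYQ' : Off x Y Q'
          oYQ' = recolour-off Y x (col Y t₁) rejoin-allowed
          Q≈Q' : Q ≈ Q'
          Q≈Q' = common-mate⇒≈ (off-trans oQY oYQ') t₁≢x Qxt₁
                   (recolour-joins Y x (col Y t₁) rejoin-allowed t₁≢x refl)
          unused : ∀ t → col Y x ≢ col Q' t
          unused t e with t ≟ x
          ... | yes refl = clash (col⇒rel Y (trans e (≔-same (col Y) x))) (Y-alone t₁ t₁≢x)
          ... | no t≢x = clash (col⇒rel Y (trans e (≔-other (col Y) t≢x))) (Y-alone t t≢x)
          isolate-allowed : ∀ t → t ≢ t₀ → col Y x ≡ col Q' t → ¬ Adj G t₀ t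
          isolate-allowed t _ e = contradiction e (unused t)
          T = recoloured Q' t₀ (col Y x) isolate-allowed
          oQT : Off t₀ Q T
          oQT = off-trans (≈⇒off Q≈Q') (recolour-off Q' t₀ (col Y x) isolate-allowed)
          T-alone : ∀ t → t ≢ t₀ → rel T t₀ t ≡ false
          T-alone t t≢ = recolour-avoids Q' t₀ (col Y x) isolate-allowed t≢ (unused t)
          Q≉T : ¬ Q ≈ T
          Q≉T e = clash (trans (≡-sym (rel≡ e t₀ x)) (trans (rel-comm Q t₀ x) Qxt₀)) (T-alone x (≢-sym t₀≢x))
          Y-row : ∀ b → b ≢ t₀ → b ≢ t₁ → rel Y t₀ b ≡ false
          Y-row b b≢t₀ b≢t₁ with b ≟ x
          ... | yes refl = trans (rel-comm Y t₀ x) (Y-alone t₀ t₀≢x)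
          ... | no b≢x = trans (≡-sym (off oQY t₀ b t₀≢x b≢x)) (trans (≡-sym (rel-cong Q Qxt₀ b))
                           (no-third-mate t₁≢x b≢x t₁≢t₀ b≢t₀ b≢t₁ Qxt₁))
          T-row : ∀ b → b ≢ x → b ≢ t₁ → rel T x b ≡ false
          T-row b b≢x b≢t₁ with b ≟ t₀
          ... | yes refl = trans (rel-comm T x t₀) (T-alone x (≢-sym t₀≢x))
          ... | no b≢t₀ = trans (≡-sym (off oQT x b (≢-sym t₀≢x) b≢t₀))
                            (no-third-mate t₁≢x b≢x t₁≢t₀ b≢t₀ b≢t₁ Qxt₁)
          rows : ∀ a → a ≡ x ⊎ a ≡ t₀ → ∀ b → b ≢ t₁ → rel T a b ≡ rel Y a b
          rows .x (inj₁ refl) b b≢t₁ with b ≟ x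
          ... | yes refl = trans (rel-refl T x) (≡-sym (rel-refl Y x))
          ... | no b≢x = trans (T-row b b≢x b≢t₁) (≡-sym (Y-alone b b≢x))
          rows a (inj₂ refl) b b≢t₁ with b ≟ t₀
          ... | yes refl = trans (rel-refl T t₀) (≡-sym (rel-refl Y t₀))
          ... | no b≢t₀ = trans (T-alone b b≢t₀) (≡-sym (Y-row b b≢t₀ b≢t₁))
          touched : ∀ a → a ≡ x ⊎ a ≡ t₀ ⊎ (a ≢ x × a ≢ t₀)
          touched a with a ≟ x | a ≟ t₀
          ... | yes p | _ = inj₁ p
          ... | no _ | yes p = inj₂ (inj₁ p)
          ... | no p | no q = inj₂ (inj₂ (p , q))
          -- `T` has the parts {t₀} and {x, t₁}, `Y` has {x} and {t₀, t₁}; only `t₁` has to move.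
          T≡Y : ∀ a b → a ≢ t₁ → b ≢ t₁ → rel T a b ≡ rel Y a b
          T≡Y a b a≢t₁ b≢t₁ with touched a | touched b
          ... | inj₁ p | _ = rows a (inj₁ p) b b≢t₁
          ... | inj₂ (inj₁ p) | _ = rows a (inj₂ p) b b≢t₁
          ... | inj₂ (inj₂ _) | inj₁ q =
            trans (rel-comm T a b) (trans (rows b (inj₁ q) a a≢t₁) (rel-comm Y b a))
          ... | inj₂ (inj₂ _) | inj₂ (inj₁ q) =
            trans (rel-comm T a b) (trans (rows b (inj₂ q) a a≢t₁) (rel-comm Y b a))
          ... | inj₂ (inj₂ (a≢x , a≢t₀)) | inj₂ (inj₂ (b≢x , b≢t₀)) =
            trans (≡-sym (off oQT a b a≢t₀ b≢t₀)) (off oQY a b a≢x b≢x)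

        impossible : ⊥
        impossible with any? (λ t → ¬? (t ≟ x) ×-dec ¬? (t ≟ t₀) ×-dec (rel Q x t Bool.≟ true))
        ... | yes (t₁ , t₁≢x , t₁≢t₀ , e) = three t₁ t₁≢x t₁≢t₀ e
        ... | no none = two λ t t≢x t≢t₀ → ¬true⇒false λ e → none (t , t≢x , t≢t₀ , e)

      x≡v : x ≡ v
      x≡v with x ≟ v
      ... | yes p = p
      ... | no x≢v = ⊥-elim (impossible x≢v)

    -- `isolated-by-one` at `Q` and at `R` gives x = v and y = u. They share a part of `X`, so they
    -- are non-adjacent; both are alone in `Y` but have mates in `P`, so two colours can be saved.
    merge-or-separate : ∀ {P Q R X Y : BellVertex G k} {u v x y} →
      Separated Q → Separated R → Off u P Q → Off v P R → x ≢ u → y ≢ v → x ≢ y →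
      Off x Q X → Off x Q Y → Off y R X → Off y R Y →
      ¬ Q ≈ X → ¬ Q ≈ Y → ¬ R ≈ X → ¬ R ≈ Y →
      rel X x y ≡ true → rel Y x y ≡ false →
      ¬ Adj G u v × ∃[ m ] k ≡ suc (suc m) × Colourable G m
    merge-or-separate {P} {Q} {R} {X} {Y} {u} {v} {x} {y}
        sepQ sepR oPQ oPR x≢u y≢v x≢y oQX oQY oRX oRY Q≉X Q≉Y R≉X R≉Y Xxy Yxy
      with isolated-by-one sepQ oPQ oPR x≢u x≢y oQX oQY oRX oRY Q≉X Q≉Y Xxy Yxy
         | isolated-by-one sepR oPR oPQ y≢v (≢-sym x≢y) oRX oRY oQX oQY R≉X R≉Y
             (trans (rel-comm X y x) Xxy) (trans (rel-comm Y y x) Yxy)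
    ... | refl , v-alone , t , t≢v , t≢u , Qvt | refl , u-alone , s , s≢u , s≢v , Rus =
      rel-nonadj X (trans (rel-comm X u v) Xxy) ,
      two-singletons⇒colourable Y P (≢-sym x≢y)
        (λ a b a≢u a≢v b≢u b≢v → trans (off oPQ a b a≢u b≢u) (off oQY a b a≢v b≢v))
        u-alone v-alone
        s≢u s≢v (trans (off oPR u s (≢-sym x≢y) s≢v) Rus)
        t≢u t≢v (trans (off oPQ v t x≢y t≢u) Qvt)

  -- Separatedness at Q and R forces X and Y to differ from Q by moving one vertex x and from R by
  -- moving one vertex y, so X and Y differ only in whether x and y are together.
  adjacent-common-neighbours : ∀ {P Q R X Y : BellVertex G k} {u v} →
    Separated Q → Separated R → Off u P Q → Off v P R → ¬ Close Q R →
    Close Q X → Close R X → Close Q Y → Close R Y → Close X Y →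
    ¬ Close P X → ¬ Close P Y → ¬ X ≈ Y →
    ¬ Adj G u v × ∃[ m ] k ≡ suc (suc m) × Colourable G m
  adjacent-common-neighbours {P} {Q} {R} {X} {Y} {u} {v} sepQ sepR oPQ oPR ¬QR
      (x , oQX) (y , oRX) (x' , oQY) (y' , oRY) XY ¬PX ¬PY X≉Y
    with sepQ oQX (off-≉ oPQ ¬PX) oQY (off-≉ oPQ ¬PY) XY
       | sepR oRX (off-≉ oPR ¬PX) oRY (off-≉ oPR ¬PY) XY
  ... | refl | refl = by-cases
    where
    Q≉X = off-≉ oPQ ¬PX
    Q≉Y = off-≉ oPQ ¬PY
    R≉X = off-≉ oPR ¬PX
    R≉Y = off-≉ oPR ¬PY
    x≢u : x ≢ u
    x≢u refl = ¬PX (x , off-trans oPQ oQX)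
    y≢v : y ≢ v
    y≢v refl = ¬PX (y , off-trans oPR oRX)
    x≢y : x ≢ y
    x≢y refl = ¬QR (x , off-trans oQX (off-sym oRX))
    same-xy⇒≈ : rel X x y ≡ rel Y x y → X ≈ Y
    same-xy⇒≈ e = off⇒≈ (off-trans (off-sym oQX) oQY) row
      where
      row : ∀ t → t ≢ x → rel X x t ≡ rel Y x t
      row t t≢x with t ≟ y
      ... | yes refl = e
      ... | no t≢y = off (off-trans (off-sym oRX) oRY) x t x≢y t≢y
    by-cases : ¬ Adj G u v × ∃[ m ] k ≡ suc (suc m) × Colourable G m
    by-cases with rel X x y in eX | rel Y x y in eY
    ... | true  | false = merge-or-separate sepQ sepR oPQ oPR x≢u y≢v x≢y
                            oQX oQY oRX oRY Q≉X Q≉Y R≉X R≉Y eX eY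
    ... | false | true  = merge-or-separate sepQ sepR oPQ oPR x≢u y≢v x≢y
                            oQY oQX oRY oRX Q≉Y Q≉X R≉Y R≉X eY eX
    ... | true  | true  = contradiction (same-xy⇒≈ (trans eX (≡-sym eY))) X≉Y
    ... | false | false = contradiction (same-xy⇒≈ (trans eX (≡-sym eY))) X≉Y

-- Reconstruction

module _ {n : ℕ} {G : Graph n} {k : ℕ} where

  module Isolate (S : BellVertex G k) (u : Fin n) (x : Fin k) (unused : ∀ t → t ≢ u → x ≢ col S t) where

    private
      allowed : ∀ t → t ≢ u → x ≡ col S t → ¬ Adj G u t
      allowed t t≢u e = contradiction e (unused t t≢u)

    isolated : BellVertex G k
    isolated = recoloured S u x allowed

    isolate-off : Off u S isolated
    isolate-off = recolour-off S u x allowed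

    isolate-alone : ∀ t → t ≢ u → rel isolated u t ≡ false
    isolate-alone t t≢u = recolour-avoids S u x allowed t≢u (unused t t≢u)

    isolate-≉ : ∀ {a} → a ≢ u → rel S u a ≡ true → ¬ S ≈ isolated
    isolate-≉ {a} a≢u e S≈ = clash (trans (≡-sym (rel≡ S≈ u a)) e) (isolate-alone a a≢u)

  open Isolate

  record Roomy : Set where
    field
      P       : BellVertex G k
      mates   : ∀ u → HasMates P u
      f       : Fin k
      f-free  : ∀ a → f ≢ col P a

    Q : Fin n → BellVertex G k
    Q u = isolated P u f (λ t _ → f-free t)

    Q-off : ∀ u → Off u P (Q u)
    Q-off u = isolate-off P u f (λ t _ → f-free t)

    Q-alone : ∀ u t → t ≢ u → rel (Q u) u t ≡ false
    Q-alone u = isolate-alone P u f (λ t _ → f-free t)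

    P≉Q : ∀ u → ¬ P ≈ Q u
    P≉Q u with mates u u u
    ... | a , a≢u , _ , _ , e = isolate-≉ P u f (λ t _ → f-free t) a≢u e

    P-separated : Separated P
    P-separated = separated P (λ s t _ → inj₁ (mates s))

    Q-apart : ∀ {u v} → u ≢ v → ¬ Close (Q u) (Q v)
    Q-apart {u} {v} u≢v cl = u≢v (P-separated (Q-off u) (P≉Q u) (Q-off v) (P≉Q v) cl)

    private
      -- Otherwise take a mate of `u` in `P` outside {x, y}. It stays with `u` on the way to `X`
      -- through `Q v`, since the edge keeps `v` out of the part of `u`, but is split from `u` on
      -- the way through `Q u`.
      endpoint : ∀ {u v x y X} → Adj G u v → Off x (Q u) X → Off y (Q v) X → u ≡ x ⊎ u ≡ y
      endpoint {u} {v} {x} {y} uv ox oy with u ≟ x | u ≟ y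
      ... | yes p | _ = inj₁ p
      ... | no _ | yes p = inj₂ p
      ... | no u≢x | no u≢y with mates u x y
      ...   | a , a≢u , a≢x , a≢y , e = clash
        (trans (≡-sym (off oy u a u≢y a≢y)) (trans (≡-sym (off (Q-off v) u a
          (λ { refl → irrefl G uv }) (λ { refl → rel-nonadj P e uv }))) e))
        (trans (≡-sym (off ox u a u≢x a≢x)) (Q-alone u a a≢u))

    -- By `endpoint`, (x, y) is (u, v) or (v, u). In the first case `X` agrees with `P` off `u` and
    -- off `v`, and the edge separates `u` and `v` in both. In the second, `u` and `v` are alone in
    -- `X`, which with their mates in `P` saves two colours, against the first hypothesis.
    adjacent⇒unique-common-neighbour : (∀ m → k ≡ suc (suc m) → ¬ Colourable G m) →
      ∀ {u v X} → Adj G u v → Close (Q u) X → Close (Q v) X → P ≈ X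
    adjacent⇒unique-common-neighbour few {u} {v} {X} uv (x , ox) (y , oy)
      with endpoint uv ox oy | endpoint (sym G uv) oy ox
    ... | inj₁ refl | inj₂ refl = contradiction uv (irrefl G)
    ... | inj₂ refl | inj₁ refl = contradiction uv (irrefl G)
    ... | inj₁ refl | inj₁ refl = off⇒≈ (off-trans (Q-off u) ox) row
      where
      row : ∀ t → t ≢ u → rel P u t ≡ rel X u t
      row t t≢u with t ≟ v
      ... | yes refl = trans (adj-rel P uv) (≡-sym (adj-rel X uv))
      ... | no t≢v = off (off-trans (Q-off v) oy) u t (λ { refl → irrefl G uv }) t≢v
    ... | inj₂ refl | inj₂ refl = ⊥-elim (impossible (mates u v v) (mates v u u))
      where
      u≢v : u ≢ v
      u≢v refl = irrefl G uv
      alone : ∀ {u v} → Adj G u v → Off v (Q u) X → ∀ t → t ≢ u → rel X u t ≡ false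
      alone {u} {v} uv o t t≢u with t ≟ v
      ... | yes refl = adj-rel X uv
      ... | no t≢v = trans (≡-sym (off o u t (λ { refl → irrefl G uv }) t≢v)) (Q-alone u t t≢u)
      impossible : (∃[ s ] s ≢ u × s ≢ v × s ≢ v × rel P u s ≡ true) →
                   (∃[ t ] t ≢ v × t ≢ u × t ≢ u × rel P v t ≡ true) → ⊥
      impossible (s , s≢u , s≢v , _ , us) (t , t≢v , t≢u , _ , vt)
        with two-singletons⇒colourable X P u≢v
               (λ a b a≢u a≢v b≢u b≢v → trans (off (Q-off u) a b a≢u b≢u) (off ox a b a≢v b≢v))
               (alone uv ox) (alone (sym G uv) oy) s≢u s≢v us t≢u t≢v vt
      ... | m , k≡ , colourable = few m k≡ colourable


  -- Parts of five vertices keep four when `u` is isolated; `u` itself is alone in `Q u`, hence the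
  -- condition `v ≢ u`. The second free colour `g` lets `u` and `v` be singletons at once.
  record VeryRoomy : Set where
    field
      roomy   : Roomy
    private module R = Roomy roomy
    field
      Q-mates : ∀ u v → v ≢ u → HasMates (R.Q u) v
      g       : Fin k
      g-free  : ∀ a → g ≢ col R.P a
      f≢g     : R.f ≢ g

    Q-separated : ∀ u → Separated (R.Q u)
    Q-separated u = separated (R.Q u) one-has-mates
      where
      one-has-mates : ∀ s t → s ≢ t → HasMates (R.Q u) s ⊎ HasMates (R.Q u) t
      one-has-mates s t s≢t with s ≟ u
      ... | no s≢u = inj₁ (Q-mates u s s≢u)
      ... | yes refl = inj₂ (Q-mates u t (≢-sym s≢t))

    g-free-Q : ∀ u t → g ≢ col (R.Q u) t
    g-free-Q u t e with t ≟ u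
    ... | yes refl = f≢g (trans (≡-sym (≔-same (col R.P) u)) (≡-sym e))
    ... | no t≢u = g-free t (trans e (≔-other (col R.P) t≢u))

    -- Labelling the neighbours of `Q u` takes a genuine move of every vertex; `u` itself moves back
    -- to its part in `P`.
    Q-movable : ∀ u v → ∃[ T ] Off v (R.Q u) T × ¬ R.Q u ≈ T
    Q-movable u v with v ≟ u
    ... | yes refl = R.P , off-sym (R.Q-off u) , λ e → R.P≉Q u (≈-sym e)
    ... | no v≢u with Q-mates u v v≢u v v
    ...   | a , a≢v , _ , _ , e = isolated (R.Q u) v g (λ t _ → g-free-Q u t) ,
      isolate-off (R.Q u) v g (λ t _ → g-free-Q u t) ,
      isolate-≉ (R.Q u) v g (λ t _ → g-free-Q u t) a≢v e

    module NonAdjacent {u v} (u≢v : u ≢ v) (¬uv : ¬ Adj G u v) where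

      private
        allowed : ∀ t → t ≢ v → R.f ≡ col (R.Q u) t → ¬ Adj G v t
        allowed t t≢v e with t ≟ u
        ... | yes refl = ¬uv ∘ sym G
        ... | no t≢u = contradiction (trans e (≔-other (col R.P) t≢u)) (R.f-free t)

      -- In `Q u` the colour `f` belongs to `u` alone, so `v` joins {u}.
      together : BellVertex G k
      together = recoloured (R.Q u) v R.f allowed

      apart : BellVertex G k
      apart = isolated (R.Q u) v g (λ t _ → g-free-Q u t)

      together-off : Off v (R.Q u) together
      together-off = recolour-off (R.Q u) v R.f allowed

      apart-off : Off v (R.Q u) apart
      apart-off = isolate-off (R.Q u) v g (λ t _ → g-free-Q u t)

      together-v : ∀ t → t ≢ v → t ≢ u → rel together v t ≡ false
      together-v t t≢v t≢u = recolour-avoids (R.Q u) v R.f allowed t≢v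
        λ e → R.f-free t (trans e (≔-other (col R.P) t≢u))

      apart-v : ∀ t → t ≢ v → rel apart v t ≡ false
      apart-v = isolate-alone (R.Q u) v g (λ t _ → g-free-Q u t)

      together≉apart : ¬ together ≈ apart
      together≉apart e = clash
        (recolour-joins (R.Q u) v R.f allowed u≢v (≡-sym (≔-same (col R.P) u)))
        (trans (rel≡ e v u) (apart-v u u≢v))

      -- The condition on `v` admits `u` as a mate, so that it holds for both `together` and
      -- `apart`.
      module _ {X} (oX : Off v (R.Q u) X) (v-row : ∀ t → t ≢ v → t ≢ u → rel X v t ≡ false) where

        off-from-Qv : Off u (R.Q v) X
        off-from-Qv = off-by-row {x = v}
          (λ a b a≢v a≢u b≢v b≢u → trans (≡-sym (off (R.Q-off v) a b a≢v b≢v))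
            (trans (off (R.Q-off u) a b a≢u b≢u) (off oX a b a≢v b≢v)))
          (λ t t≢v t≢u → trans (R.Q-alone v t t≢v) (≡-sym (v-row t t≢v t≢u)))

        -- In `X` neither `u` nor `v` has a mate outside {u, v}. A single moved vertex `t` differs
        -- from one of them, whose mates in `P` would have to persist.
        not-close-to-P : ¬ Close R.P X
        not-close-to-P (t , o) with u ≟ t | v ≟ t
        ... | yes refl | yes refl = u≢v refl
        ... | no u≢t | _ with R.mates u v t
        ...   | a , a≢u , a≢v , a≢t , e = clash e (trans (off o u a u≢t a≢t)
                  (trans (≡-sym (off oX u a u≢v a≢v)) (R.Q-alone u a a≢u)))
        not-close-to-P (t , o) | yes _ | no v≢t with R.mates v u t
        ...   | a , a≢v , a≢u , a≢t , e = clash e (trans (off o v a v≢t a≢t) (v-row a a≢v a≢u))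

-- Roomy partitions from chromatic colourings

module _ {n k : ℕ} (G : Graph n) {c : Fin n → Fin k} (proper : ProperColouring G k c) where

  private
    P₀ = fromColouring {G = G} c proper

  LargeClasses⇒Roomy : LargeClasses 4 c → ∀ f → (∀ a → f ≢ c a) → Roomy {G = G} {k}
  LargeClasses⇒Roomy large f f-free = record
    { P = P₀ ; mates = mates' ; f = f ; f-free = f-free }
    where
    mates' : ∀ u → HasMates P₀ u
    mates' u t r with large u (u ∷ t ∷ r ∷ []) ≤-refl
    ... | a , a∉ , e = a , a∉ ∘ here , a∉ ∘ there ∘ here , a∉ ∘ there ∘ there ∘ here ,
                       col⇒rel P₀ (≡-sym e)

  LargeClasses⇒VeryRoomy : LargeClasses 5 c → ∀ f g → (∀ a → f ≢ c a) → (∀ a → g ≢ c a) → f ≢ g →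
                           VeryRoomy {G = G} {k}
  LargeClasses⇒VeryRoomy large f g f-free g-free f≢g = record
    { roomy = roomy' ; Q-mates = Q-mates' ; g = g ; g-free = g-free ; f≢g = f≢g }
    where
    roomy' = LargeClasses⇒Roomy (LargeClasses-mono {c = c} (n≤1+n 4) large) f f-free
    Q-mates' : ∀ u v → v ≢ u → HasMates (Roomy.Q roomy' u) v
    Q-mates' u v v≢u t r with large v (v ∷ t ∷ r ∷ u ∷ []) ≤-refl
    ... | a , a∉ , e = a , a∉ ∘ here , a∉ ∘ there ∘ here , a∉ ∘ there ∘ there ∘ here ,
      trans (≡-sym (off (Roomy.Q-off roomy' u) v a v≢u (a∉ ∘ there ∘ there ∘ there ∘ here)))
            (col⇒rel P₀ (≡-sym e))

module _ {n k χ : ℕ} (c : Fin n → Fin χ) where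

  module _ (χ<k : χ < k) where

    widen : Fin n → Fin k
    widen a = inject≤ (c a) (<⇒≤ χ<k)

    widen-injective : ∀ {a b} → widen a ≡ widen b → c a ≡ c b
    widen-injective {a} {b} e = inject≤-injective (<⇒≤ χ<k) (<⇒≤ χ<k) (c a) (c b) e

    widen-free : ∀ f → χ ≤ toℕ f → ∀ a → f ≢ widen a
    widen-free f χ≤f a refl = <⇒≱ (toℕ<n (c a))
      (subst (χ ≤_) (toℕ-inject≤ (c a) (<⇒≤ χ<k)) χ≤f)

    widen-proper : (G : Graph n) → ProperColouring G χ c → ProperColouring G k widen
    widen-proper G proper a b ab e = proper a b ab (widen-injective e)

    widen-large : ∀ {m} → LargeClasses m c → LargeClasses m widen
    widen-large large u xs len with large u xs len
    ... | a , a∉ , e = a , a∉ , cong (λ i → inject≤ i (<⇒≤ χ<k)) e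

  roomy-from : (G : Graph n) → ProperColouring G χ c → LargeClasses 4 c → χ < k → Roomy {G = G} {k}
  roomy-from G proper large χ<k = LargeClasses⇒Roomy G (widen-proper χ<k G proper)
    (widen-large χ<k large) (fromℕ< χ<k)
    (widen-free χ<k (fromℕ< χ<k) (≤-reflexive (≡-sym (toℕ-fromℕ< χ<k))))

  veryRoomy-from : (G : Graph n) → ProperColouring G χ c → LargeClasses 5 c → suc χ < k →
                   VeryRoomy {G = G} {k}
  veryRoomy-from G proper large 1+χ<k = LargeClasses⇒VeryRoomy G (widen-proper χ<k G proper)
    (widen-large χ<k large) f g
    (widen-free χ<k f (≤-reflexive (≡-sym toℕ-f)))
    (widen-free χ<k g (≤-trans (n≤1+n χ) (≤-reflexive (≡-sym toℕ-g))))
    λ e → <-irrefl (trans (≡-sym toℕ-f) (trans (cong toℕ e) toℕ-g)) (n<1+n χ)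
    where
    χ<k : χ < k
    χ<k = <⇒≤ 1+χ<k
    f = fromℕ< χ<k
    g = fromℕ< 1+χ<k
    toℕ-f : toℕ f ≡ χ
    toℕ-f = toℕ-fromℕ< χ<k
    toℕ-g : toℕ g ≡ suc χ
    toℕ-g = toℕ-fromℕ< 1+χ<k

-- Injections of a finite set

fold-cancel : ∀ {A : Set} {f : A → A} → Injective _≡_ _≡_ f → ∀ x i d →
              fold x f i ≡ fold x f (i + d) → x ≡ fold x f d
fold-cancel inj x zero    d e = e
fold-cancel inj x (suc i) d e = fold-cancel inj x i d (inj e)

module _ {n : ℕ} {f : Fin n → Fin n} (f-injective : Injective _≡_ _≡_ f) where

  -- The pigeonhole principle is applied to n² + 1 pairs of iterates, so that one positive exponent
  -- serves both `u` and `v`.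
  common-period : ∀ u v → ∃[ m ] fold u f (suc m) ≡ u × fold v f (suc m) ≡ v
  common-period u v
    with pigeonhole (n<1+n (n * n)) (λ i → combine (fold u f (toℕ i)) (fold v f (toℕ i)))
  ... | i , j , i<j , e with combine-injective _ _ _ _ e
  ... | eu , ev with m≤n⇒∃[o]m+o≡n i<j
  ... | m , i+m≡j = m ,
      ≡-sym (fold-cancel f-injective u (toℕ i) (suc m) (trans eu (cong (fold u f) shift))) ,
      ≡-sym (fold-cancel f-injective v (toℕ i) (suc m) (trans ev (cong (fold v f) shift)))
    where
    shift : toℕ j ≡ toℕ i + suc m
    shift = trans (≡-sym i+m≡j) (≡-sym (+-suc (toℕ i) m))

  injective⇒surjective : ∀ y → ∃[ x ] f x ≡ y
  injective⇒surjective y with common-period y y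
  ... | m , e , _ = fold y f m , e

  injective⇒↔ : Fin n ↔ Fin n
  injective⇒↔ = mk↔ₛ′ f (proj₁ ∘ injective⇒surjective) (proj₂ ∘ injective⇒surjective)
    λ x → f-injective (proj₂ (injective⇒surjective (f x)))

  -- Applying `f` further to the related images leads, after a common period, back to `u` and `v`.
  iterate-preserves : (R : Fin n → Fin n → Set) → (∀ u v → R u v → R (f u) (f v)) →
    ∀ u v → R (f u) (f v) → R u v
  iterate-preserves R pres u v r with common-period u v
  ... | m , eu , ev = subst (λ w → R w v) eu (subst (R _) ev (go m))
    where
    go : ∀ i → R (fold u f (suc i)) (fold v f (suc i))
    go zero    = r
    go (suc i) = pres _ _ (go i)

PreservingInjection : ∀ {n} → (R₁ R₂ : Fin n → Fin n → Set) → Set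
PreservingInjection {n} R₁ R₂ =
  Σ (Fin n → Fin n) λ φ → Injective _≡_ _≡_ φ × (∀ u v → R₁ u v → R₂ (φ u) (φ v))

mutual-injections⇒↔ : ∀ {n} {R₁ R₂ : Fin n → Fin n → Set} →
  PreservingInjection R₁ R₂ → PreservingInjection R₂ R₁ →
  Σ (Fin n ↔ Fin n) λ f → ∀ u v → (R₁ u v → R₂ (Inverse.to f u) (Inverse.to f v))
                                × (R₂ (Inverse.to f u) (Inverse.to f v) → R₁ u v)
mutual-injections⇒↔ {R₁ = R₁} (φ , φ-inj , p) (ψ , ψ-inj , q) = injective⇒↔ φ-inj , λ u v →
  p u v , λ r → iterate-preserves (φ-inj ∘ ψ-inj) R₁ (λ u v → q _ _ ∘ p u v) u v (q _ _ r)

-- Transport along an isomorphism of Bell colouring graphs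

NonAdj : ∀ {n} → Graph n → Fin n → Fin n → Set
NonAdj G u v = ¬ Adj G u v

module Transfer {n₁ n₂ k₁ k₂ : ℕ} {G₁ : Graph n₁} {G₂ : Graph n₂}
                (iso : BellIso G₁ k₁ G₂ k₂) (z₁ : Fin n₁) (z₂ : Fin n₂) where

  open BellIso iso

  to≈ : ∀ {A B} → A ≈ B → to A ≈ to B
  to≈ {A} {B} e = agree (to-cong A B (rel≡ e))

  to-from≈ : ∀ A → to (from A) ≈ A
  to-from≈ A = agree (to-from A)

  to≈⁻ : ∀ {A B} → to A ≈ to B → A ≈ B
  to≈⁻ {A} {B} e = ≈-trans (≈-sym (from-to≈ A)) (≈-trans from≈ (from-to≈ B))
    where
    from-to≈ : ∀ A → from (to A) ≈ A
    from-to≈ A = agree (from-to A)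
    from≈ : from (to A) ≈ from (to B)
    from≈ = agree (from-cong (to A) (to B) (rel≡ e))

  close-to : ∀ {A B} → Close A B → Close (to A) (to B)
  close-to {A} {B} (x , o) with A ≈? B
  -- Equal partitions agree off every vertex; `z₂` supplies one.
  ... | yes A≈B = z₂ , ≈⇒off (to≈ A≈B)
  ... | no A≉B with adj-pres A B (A≉B ∘ agree , x , off o)
  ...   | _ , y , o' = y , agreeOff o'

  close-to⁻ : ∀ {A B} → Close (to A) (to B) → Close A B
  close-to⁻ {A} {B} (x , o) with to A ≈? to B
  ... | yes A≈B = z₁ , ≈⇒off (to≈⁻ A≈B)
  ... | no A≉B with adj-refl A B (A≉B ∘ agree , x , off o)
  ...   | _ , y , o' = y , agreeOff o'

  module Label (S : BellVertex G₁ k₁) (sep : Separated S)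
               (movable : ∀ i → ∃[ T ] Off i S T × ¬ S ≈ T) where

    private
      T : Fin n₁ → BellVertex G₁ k₁
      T i = proj₁ (movable i)
      oT : ∀ i → Off i S (T i)
      oT i = proj₁ (proj₂ (movable i))
      S≉T : ∀ i → ¬ S ≈ T i
      S≉T i = proj₂ (proj₂ (movable i))

    label : Fin n₁ → Fin n₂
    label i = proj₁ (close-to (i , oT i))

    label-off : ∀ i → Off (label i) (to S) (to (T i))
    label-off i = proj₂ (close-to (i , oT i))

    -- Equal labels make the images of `T i` and `T j` close, hence also `T i` and `T j` themselves,
    -- and `S` is separated.
    label-injective : Injective _≡_ _≡_ label
    label-injective {i} {j} e = sep (oT i) (S≉T i) (oT j) (S≉T j)
      (close-to⁻ (label i , off-trans (off-sym (label-off i))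
        (subst (λ l → Off l (to S) (to (T j))) (≡-sym e) (label-off j))))

    -- Surjectivity writes the moved vertices as `label i` and `label j`. The preimages of `A` and
    -- `B` are close to `T i` and `T j`, so by separatedness of `S` they move `i` and `j`; being
    -- close to each other, they give i = j.
    separated-to : (∀ j → ∃[ i ] label i ≡ j) → Separated (to S)
    separated-to surj {A} {B} {a} {b} oA nA oB nB AB with surj a | surj b
    ... | i , refl | j , refl = cong label (trans (≡-sym (index≡ oA nA)) (trans
            (sep (moves oA) (≉from nA) (moves oB) (≉from nB)
              (close-to⁻ (close-resp-≈ (≈-sym (to-from≈ A)) (≈-sym (to-from≈ B)) AB)))
            (index≡ oB nB)))
      where
      ≉from : ∀ {A} → ¬ to S ≈ A → ¬ S ≈ from A
      ≉from {A} ne e = ne (≈-trans (to≈ e) (to-from≈ A))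
      close-S : ∀ {A a} → Off a (to S) A → Close S (from A)
      close-S {A} {a} o = close-to⁻ (a , off-trans o (≈⇒off (≈-sym (to-from≈ A))))
      moves : ∀ {A a} (o : Off a (to S) A) → Off (proj₁ (close-S o)) S (from A)
      moves o = proj₂ (close-S o)
      index≡ : ∀ {A i} (o : Off (label i) (to S) A) → ¬ to S ≈ A → proj₁ (close-S o) ≡ i
      index≡ {A} {i} o ne = sep (moves o) (≉from ne) (oT i) (S≉T i)
        (close-to⁻ (label i , off-trans (≈⇒off (to-from≈ A)) (off-trans (off-sym o) (label-off i))))

  -- Used in both directions this equates the orders, whereupon every injective labelling is
  -- surjective, as `separated-to` demands.
  roomy⇒≤ : Roomy {G = G₁} {k₁} → n₁ ≤ n₂
  roomy⇒≤ room = injective⇒≤ label-injective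
    where
    open Roomy room
    open Label P P-separated (λ u → Q u , Q-off u , P≉Q u)

BellAdj-resp-≈P : ∀ {n} {G : Graph n} (A A' B B' : IndepPartition G) →
                  A ≈P A' → B ≈P B' → BellAdj A B → BellAdj A' B'
BellAdj-resp-≈P A A' B B' A≈ B≈ (ne , x , o) =
  (λ e → ne λ u v → trans (A≈ u v) (trans (e u v) (≡-sym (B≈ u v)))) ,
  x , λ u v p q → trans (≡-sym (A≈ u v)) (trans (o u v p q) (B≈ u v))

BellIso-sym : ∀ {n₁ n₂ k₁ k₂} {G₁ : Graph n₁} {G₂ : Graph n₂} →
              BellIso G₁ k₁ G₂ k₂ → BellIso G₂ k₂ G₁ k₁
BellIso-sym iso = record
  { to = from ; from = to ; to-cong = from-cong ; from-cong = to-cong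
  ; from-to = to-from ; to-from = from-to
  ; adj-pres = λ A B adj → adj-refl (from A) (from B)
      (BellAdj-resp-≈P (proj₁ A) (proj₁ (to (from A))) (proj₁ B) (proj₁ (to (from B)))
        (λ u v → ≡-sym (to-from A u v)) (λ u v → ≡-sym (to-from B u v)) adj)
  ; adj-refl = λ A B adj →
      BellAdj-resp-≈P (proj₁ (to (from A))) (proj₁ A) (proj₁ (to (from B))) (proj₁ B)
        (to-from A) (to-from B) (adj-pres (from A) (from B) adj)
  }
  where open BellIso iso

module Main {n k₁ k₂ : ℕ} {G₁ G₂ : Graph n} (iso : BellIso G₁ k₁ G₂ k₂) (z : Fin n) where

  open BellIso iso using (to; from)
  open Transfer iso z z

  module FromRoomy (room : Roomy {G = G₁} {k₁}) where

    open Roomy room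
    open Label P P-separated (λ u → Q u , Q-off u , P≉Q u) public

    P'-separated : Separated (to P)
    P'-separated = separated-to (injective⇒surjective label-injective)

    -- If the images were non-adjacent, the images of `Q u` and `Q v` would have a common neighbour
    -- other than `to P`; its preimage is one of `Q u` and `Q v`, hence `P`.
    preserves-adjacency : (∀ m → k₁ ≡ suc (suc m) → ¬ Colourable G₁ m) →
      ∀ u v → Adj G₁ u v → Adj G₂ (label u) (label v)
    preserves-adjacency few u v uv = decidable-stable (adj? G₂ _ _) λ ¬uv' →
      let X' , QX , RX , P≉X = non-adjacent⇒common-neighbour P'-separated
            (label-off u) (P≉Q u ∘ to≈⁻) (label-off v)
            (λ e → irrefl G₁ (subst (Adj G₁ u) (≡-sym (label-injective e)) uv)) ¬uv'
          pull : ∀ A → Close (to A) X' → Close A (from X')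
          pull = λ A cl → close-to⁻ {A} (proj₁ cl , off-trans (proj₂ cl) (≈⇒off (≈-sym (to-from≈ X'))))
      in P≉X (≈-trans (to≈ (adjacent⇒unique-common-neighbour few uv (pull (Q u) QX) (pull (Q v) RX)))
                      (to-from≈ X'))

    adjacency-injection : (∀ m → k₁ ≡ suc (suc m) → ¬ Colourable G₁ m) →
      PreservingInjection (Adj G₁) (Adj G₂)
    adjacency-injection few = label , label-injective , preserves-adjacency few

  module FromVeryRoomy (room : VeryRoomy {G = G₁} {k₁}) where

    open VeryRoomy room
    open Roomy roomy
    open FromRoomy roomy public

    Q'-separated : ∀ u → Separated (to (Q u))
    Q'-separated u = LQ.separated-to (injective⇒surjective LQ.label-injective)
      where module LQ = Label (Q u) (Q-separated u) (Q-movable u)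

    non-adjacent-image : ∀ {u v} → u ≢ v → ¬ Adj G₁ u v →
      ¬ Adj G₂ (label u) (label v) × ∃[ m ] k₂ ≡ suc (suc m) × Colourable G₂ m
    non-adjacent-image {u} {v} u≢v ¬uv = adjacent-common-neighbours
      (Q'-separated u) (Q'-separated v) (label-off u) (label-off v)
      (Q-apart u≢v ∘ close-to⁻)
      (close-to (v , together-off)) (close-to (u , off-from-Qv together-off together-v))
      (close-to (v , apart-off)) (close-to (u , off-from-Qv apart-off (λ t t≢v _ → apart-v t t≢v)))
      (close-to (v , off-trans (off-sym together-off) apart-off))
      (not-close-to-P together-off together-v ∘ close-to⁻)
      (not-close-to-P apart-off (λ t t≢v _ → apart-v t t≢v) ∘ close-to⁻)
      (together≉apart ∘ to≈⁻)
      where open NonAdjacent u≢v ¬uv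

    preserves-non-adjacency : ∀ u v → ¬ Adj G₁ u v → ¬ Adj G₂ (label u) (label v)
    preserves-non-adjacency u v ¬uv with u ≟ v
    ... | yes refl = irrefl G₂
    ... | no u≢v = proj₁ (non-adjacent-image u≢v ¬uv)

    -- Two vertices in one part of `P` form a non-adjacent pair. The conclusion rules out that only
    -- one of the graphs has two spare colours.
    spare-colours : ∃[ m ] k₂ ≡ suc (suc m) × Colourable G₂ m
    spare-colours with mates z z z
    ... | a , a≢z , _ , _ , e = proj₂ (non-adjacent-image (≢-sym a≢z) (rel-nonadj P e))

    non-adjacency-injection :
      PreservingInjection (NonAdj G₁) (NonAdj G₂) × ∃[ m ] k₂ ≡ suc (suc m) × Colourable G₂ m
    non-adjacency-injection = (label , label-injective , preserves-non-adjacency) , spare-colours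

-- The cases of one and of several spare colours

spare-colours⇒2+χ≤k : ∀ {n k χ} (G : Graph n) → IsChromaticNumber G χ →
  (∃[ m ] k ≡ suc (suc m) × Colourable G m) → suc χ < k
spare-colours⇒2+χ≤k {χ = χ} G (_ , minimal) (m , refl , colourable) with m <? χ
... | yes m<χ = contradiction colourable (minimal m m<χ)
... | no m≮χ = s≤s (s≤s (≮⇒≥ m≮χ))

k≤1+χ⇒few-colours : ∀ {n k χ} (G : Graph n) → IsChromaticNumber G χ → ¬ suc χ < k →
  ∀ m → k ≡ suc (suc m) → ¬ Colourable G m
k≤1+χ⇒few-colours G isχ ≮ m k≡ colourable = ≮ (spare-colours⇒2+χ≤k G isχ (m , k≡ , colourable))

roomy-vertex : ∀ {n k χ} (G : Graph n) → 9 * maxDegree G + 3 < n → IsChromaticNumber G χ → χ < k →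
               Roomy {G = G} {k}
roomy-vertex G lt isχ χ<k with chromatic-colouring-4 G lt isχ
... | (c , proper) , large = roomy-from c G proper large χ<k

veryRoomy-vertex : ∀ {n k χ} (G : Graph n) → 9 * maxDegree G + 3 < n → 12 < n →
                   IsChromaticNumber G χ → suc χ < k → VeryRoomy {G = G} {k}
veryRoomy-vertex G lt 12<n isχ 1+χ<k with large-chromatic-colouring G lt 12<n isχ
... | (c , proper) , large = veryRoomy-from c G proper large 1+χ<k

order≤ : ∀ {n₁ n₂ k₁ k₂ χ₁} (G₁ : Graph n₁) (G₂ : Graph n₂) →
  9 * maxDegree G₁ + 3 < n₁ → 9 * maxDegree G₂ + 3 < n₂ → IsChromaticNumber G₁ χ₁ → χ₁ < k₁ →
  BellIso G₁ k₁ G₂ k₂ → n₁ ≤ n₂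
-- Matching on the strict bounds shows both orders to be positive, which makes `fzero` available.
order≤ G₁ G₂ lt₁@(s≤s _) (s≤s _) isχ χ<k iso =
  Transfer.roomy⇒≤ iso fzero fzero (roomy-vertex G₁ lt₁ isχ χ<k)

adjacency-injection : ∀ {n k₁ k₂ χ₁} (G₁ G₂ : Graph n) → 9 * maxDegree G₁ + 3 < n →
  IsChromaticNumber G₁ χ₁ → χ₁ < k₁ → ¬ suc χ₁ < k₁ → BellIso G₁ k₁ G₂ k₂ →
  PreservingInjection (Adj G₁) (Adj G₂)
adjacency-injection G₁ G₂ lt@(s≤s _) isχ χ<k ≮ iso =
  Main.FromRoomy.adjacency-injection iso fzero (roomy-vertex G₁ lt isχ χ<k) (k≤1+χ⇒few-colours G₁ isχ ≮)

non-adjacency-injection : ∀ {n k₁ k₂ χ₁} (G₁ G₂ : Graph n) → 9 * maxDegree G₁ + 3 < n → 12 < n →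
  IsChromaticNumber G₁ χ₁ → suc χ₁ < k₁ → BellIso G₁ k₁ G₂ k₂ →
  PreservingInjection (NonAdj G₁) (NonAdj G₂) × ∃[ m ] k₂ ≡ suc (suc m) × Colourable G₂ m
non-adjacency-injection G₁ G₂ lt 12<n@(s≤s _) isχ 1+χ<k iso =
  Main.FromVeryRoomy.non-adjacency-injection iso fzero (veryRoomy-vertex G₁ lt 12<n isχ 1+χ<k)

edgeless⇒≅ : ∀ {n} (G₁ G₂ : Graph n) → (∀ u v → ¬ Adj G₁ u v) → (∀ u v → ¬ Adj G₂ u v) → G₁ ≅ G₂
edgeless⇒≅ G₁ G₂ none₁ none₂ = mk↔ₛ′ id id (λ _ → refl) (λ _ → refl) , λ u v →
  (λ uv → contradiction uv (none₁ u v)) , (λ uv → contradiction uv (none₂ u v))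

non-adjacency-↔⇒≅ : ∀ {n} (G₁ G₂ : Graph n) →
  PreservingInjection (NonAdj G₁) (NonAdj G₂) → PreservingInjection (NonAdj G₂) (NonAdj G₁) → G₁ ≅ G₂
non-adjacency-↔⇒≅ G₁ G₂ φ ψ with mutual-injections⇒↔ φ ψ
... | f , iff = f , λ u v →
  (λ uv → decidable-stable (adj? G₂ _ _) λ ¬uv → proj₂ (iff u v) ¬uv uv) ,
  (λ uv → decidable-stable (adj? G₁ u v) λ ¬uv → proj₁ (iff u v) ¬uv uv)

reconstruction : ∀ {n k₁ k₂ χ₁ χ₂} (G₁ G₂ : Graph n) →
  9 * maxDegree G₁ + 3 < n → 9 * maxDegree G₂ + 3 < n → 12 < n →
  IsChromaticNumber G₁ χ₁ → χ₁ < k₁ → IsChromaticNumber G₂ χ₂ → χ₂ < k₂ →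
  BellIso G₁ k₁ G₂ k₂ → G₁ ≅ G₂
reconstruction {k₁ = k₁} {k₂} {χ₁} {χ₂} G₁ G₂ lt₁ lt₂ 12<n isχ₁ χ₁<k₁ isχ₂ χ₂<k₂ iso
  with suc χ₁ <? k₁ | suc χ₂ <? k₂
... | no ≮₁ | no ≮₂ = mutual-injections⇒↔
  (adjacency-injection G₁ G₂ lt₁ isχ₁ χ₁<k₁ ≮₁ iso)
  (adjacency-injection G₂ G₁ lt₂ isχ₂ χ₂<k₂ ≮₂ (BellIso-sym iso))
... | yes <₁ | yes <₂ = non-adjacency-↔⇒≅ G₁ G₂
  (proj₁ (non-adjacency-injection G₁ G₂ lt₁ 12<n isχ₁ <₁ iso))
  (proj₁ (non-adjacency-injection G₂ G₁ lt₂ 12<n isχ₂ <₂ (BellIso-sym iso)))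
... | yes <₁ | no ≮₂ = contradiction
  (spare-colours⇒2+χ≤k G₂ isχ₂ (proj₂ (non-adjacency-injection G₁ G₂ lt₁ 12<n isχ₁ <₁ iso))) ≮₂
... | no ≮₁ | yes <₂ = contradiction
  (spare-colours⇒2+χ≤k G₁ isχ₁ (proj₂ (non-adjacency-injection G₂ G₁ lt₂ 12<n isχ₂ <₂ (BellIso-sym iso)))) ≮₁

theorem1p2 : ∀ {n₁ n₂} (G₁ : Graph n₁) (G₂ : Graph n₂) (k₁ k₂ : ℕ)
    → 9 * maxDegree G₁ + 3 < n₁
    → 9 * maxDegree G₂ + 3 < n₂
    → ∃[ χ₁ ] (IsChromaticNumber G₁ χ₁ × χ₁ < k₁)
    → ∃[ χ₂ ] (IsChromaticNumber G₂ χ₂ × χ₂ < k₂)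
    → BellIso G₁ k₁ G₂ k₂
    → G₁ ≅ G₂
theorem1p2 {n₁} G₁ G₂ k₁ k₂ lt₁ lt₂ (χ₁ , isχ₁ , χ₁<k₁) (χ₂ , isχ₂ , χ₂<k₂) iso
  with ≤-antisym (order≤ G₁ G₂ lt₁ lt₂ isχ₁ χ₁<k₁ iso)
                 (order≤ G₂ G₁ lt₂ lt₁ isχ₂ χ₂<k₂ (BellIso-sym iso))
... | refl with 12 <? n₁
...   | yes 12<n = reconstruction G₁ G₂ lt₁ lt₂ 12<n isχ₁ χ₁<k₁ isχ₂ χ₂<k₂ iso
...   | no ≮ = edgeless⇒≅ G₁ G₂ (edgeless G₁ lt₁ ≮) (edgeless G₂ lt₂ ≮)
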